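{- Let $G_5=C_5\times C_5$ be the elementary abelian group of order $25$, and let $S(G_5)\subseteq\mathbb{Z}$ be the set of all values of its group determinant at integer arguments. Then \[ S(G_5)\cap 5\mathbb{Z}=5^8\mathbb{Z}. \]
   Context: For a finite group $G$, the group determinant is $\Theta_G((x_g)_{g\in G})=\det(x_{gh^{ -1}})_{g,h\in G}$, and $S(G):=\{\Theta_G((a_g)_{g\in G}) : a_g\in\mathbb{Z}\}\subseteq\mathbb{Z}$. $C_n$ denotes the cyclic group of order $n$. For $n,k\ge 1$, $n^k\mathbb{Z}$ denotes the set of integer multiples of $n^k$. -}

module Defs where

open import Algebra.Bundles using (Group; CommutativeRing)
open import Algebra.Structures using (IsGroup)
import Algebra.Construct.DirectProduct as DirectProduct
import Algebra.Properties.Semiring.Exp as Exp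
import Algebra.Properties.Semiring.Sum as Sum
open import Data.Fin.Base using (Fin; zero; suc; toℕ; punchIn)
open import Data.Fin.Properties using (toℕ-injective; toℕ-fromℕ<; toℕ<n; *↔×)
open import Data.Integer.Base using (ℤ; +_)
open import Data.Integer.Divisibility.Signed using (_∣_)
import Data.Integer.Properties as ℤₚ
open import Data.Nat.Base using (ℕ; zero; suc; _+_; _*_; _∸_; NonZero; >-nonZero⁻¹)
open import Data.Nat.DivMod
  using (_%_; _mod_; m%n<n; %-distribˡ-+; m%n%n≡m%n; m<n⇒m%n≡m; n%n≡0)
open import Data.Nat.Properties
  using (+-assoc; +-comm; m∸n+n≡m; <⇒≤)
open import Data.Product.Base using (_,_; ∃)
open import Data.Product.Function.NonDependent.Setoid using (_×-inverse_)
open import Data.Product.Relation.Binary.Pointwise.NonDependent using (Pointwise-≡↔≡)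
open import Function.Bundles using (Func; Inverse)
import Function.Construct.Composition as Composition
import Function.Construct.Identity as Identity
import Function.Construct.Symmetry as Symmetry
open import Level using (Level; _⊔_; 0ℓ) renaming (suc to lsuc)
open import Relation.Binary.PropositionalEquality
  using (_≡_; refl; sym; trans; cong; cong₂; setoid; isEquivalence; module ≡-Reasoning)
open import Relation.Unary using (Pred)

private
  variable
    a b c ℓ ℓ₁ ℓ₂ : Level

-- The enumeration only serves to index the rows and columns of matrices. As
-- rows and columns use the same one, the group determinant does not depend on it.
record FiniteGroup c ℓ : Set (lsuc (c ⊔ ℓ)) where
  field
    group       : Group c ℓ
    order       : ℕ
    enumeration : Inverse (setoid (Fin order)) (Group.setoid group)

  open Group group public

  element : Fin order → Carrier
  element = Inverse.to enumeration

module _ (n : ℕ) .{{_ : NonZero n}} where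

  infixl 6 _+ₘ_

  _+ₘ_ : Fin n → Fin n → Fin n
  i +ₘ j = (toℕ i + toℕ j) mod n

  0ₘ : Fin n
  0ₘ = 0 mod n

  -ₘ_ : Fin n → Fin n
  -ₘ i = (n ∸ toℕ i) mod n

  private
    open ≡-Reasoning

    toℕ-mod : ∀ m → toℕ (m mod n) ≡ m % n
    toℕ-mod m = toℕ-fromℕ< (m%n<n m n)

    %-+-left : ∀ m k → (m % n + k) % n ≡ (m + k) % n
    %-+-left m k = begin
      (m % n + k) % n          ≡⟨ %-distribˡ-+ (m % n) k n ⟩
      (m % n % n + k % n) % n  ≡⟨ cong (λ t → (t + k % n) % n) (m%n%n≡m%n m n) ⟩
      (m % n + k % n) % n      ≡⟨ %-distribˡ-+ m k n ⟨
      (m + k) % n              ∎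

    +ₘ-comm : ∀ i j → i +ₘ j ≡ j +ₘ i
    +ₘ-comm i j = cong (_mod n) (+-comm (toℕ i) (toℕ j))

    toℕ-mod-+ₘ : ∀ m j → toℕ ((m mod n) +ₘ j) ≡ (m + toℕ j) % n
    toℕ-mod-+ₘ m j = begin
      toℕ ((m mod n) +ₘ j)         ≡⟨ toℕ-mod (toℕ (m mod n) + toℕ j) ⟩
      (toℕ (m mod n) + toℕ j) % n  ≡⟨ cong (λ t → (t + toℕ j) % n) (toℕ-mod m) ⟩
      (m % n + toℕ j) % n          ≡⟨ %-+-left m (toℕ j) ⟩
      (m + toℕ j) % n              ∎

    +ₘ-assoc : ∀ i j k → (i +ₘ j) +ₘ k ≡ i +ₘ (j +ₘ k)
    +ₘ-assoc i j k = toℕ-injective (begin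
      toℕ ((i +ₘ j) +ₘ k)              ≡⟨ toℕ-mod-+ₘ (toℕ i + toℕ j) k ⟩
      (toℕ i + toℕ j + toℕ k) % n      ≡⟨ cong (_% n) (+-assoc (toℕ i) _ _) ⟩
      (toℕ i + (toℕ j + toℕ k)) % n    ≡⟨ cong (_% n) (+-comm (toℕ i) _) ⟩
      ((toℕ j + toℕ k) + toℕ i) % n    ≡⟨ toℕ-mod-+ₘ (toℕ j + toℕ k) i ⟨
      toℕ ((j +ₘ k) +ₘ i)              ≡⟨ cong toℕ (+ₘ-comm (j +ₘ k) i) ⟩
      toℕ (i +ₘ (j +ₘ k))              ∎)

    +ₘ-identityˡ : ∀ i → 0ₘ +ₘ i ≡ i
    +ₘ-identityˡ i =
      toℕ-injective (trans (toℕ-mod-+ₘ 0 i) (m<n⇒m%n≡m (toℕ<n i)))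

    -ₘ-inverseˡ : ∀ i → (-ₘ i) +ₘ i ≡ 0ₘ
    -ₘ-inverseˡ i = toℕ-injective (begin
      toℕ ((-ₘ i) +ₘ i)        ≡⟨ toℕ-mod-+ₘ (n ∸ toℕ i) i ⟩
      (n ∸ toℕ i + toℕ i) % n  ≡⟨ cong (_% n) (m∸n+n≡m (<⇒≤ (toℕ<n i))) ⟩
      n % n                    ≡⟨ n%n≡0 n ⟩
      0                        ≡⟨ m<n⇒m%n≡m (>-nonZero⁻¹ n) ⟨
      0 % n                    ≡⟨ toℕ-mod 0 ⟨
      toℕ 0ₘ                   ∎)

    +ₘ-isGroup : IsGroup _≡_ _+ₘ_ 0ₘ -ₘ_
    +ₘ-isGroup = record
      { isMonoid = record
        { isSemigroup = record
          { isMagma = record { isEquivalence = isEquivalence ; ∙-cong = cong₂ _+ₘ_ }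
          ; assoc   = +ₘ-assoc
          }
        ; identity = +ₘ-identityˡ , λ i → trans (+ₘ-comm i 0ₘ) (+ₘ-identityˡ i)
        }
      ; inverse = -ₘ-inverseˡ , λ i → trans (+ₘ-comm i (-ₘ i)) (-ₘ-inverseˡ i)
      ; ⁻¹-cong = cong -ₘ_
      }

  C : FiniteGroup 0ℓ 0ℓ
  C = record
    { group       = record { isGroup = +ₘ-isGroup }
    ; order       = n
    ; enumeration = Identity.inverse (setoid (Fin n))
    }

infixr 7 _×ᴳ_

_×ᴳ_ : FiniteGroup a ℓ₁ → FiniteGroup b ℓ₂ → FiniteGroup (a ⊔ b) (ℓ₁ ⊔ ℓ₂)
G ×ᴳ H = record
  { group       = DirectProduct.group G.group H.group
  ; order       = G.order * H.order
  ; enumeration =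
      Composition.inverse (*↔× {G.order} {H.order})
        (Composition.inverse (Symmetry.inverse Pointwise-≡↔≡)
          (G.enumeration ×-inverse H.enumeration))
  }
  where module G = FiniteGroup G; module H = FiniteGroup H

module _ (R : CommutativeRing c ℓ) where
  private
    module R = CommutativeRing R
    open Sum R.semiring using (sum)
    open Exp R.semiring using (_^_)

  -- Laplace expansion along the first row; the second factor of the product is
  -- the minor obtained by deleting that row and column j.
  det : ∀ {n} → (Fin n → Fin n → R.Carrier) → R.Carrier
  det {zero}  A = R.1#
  det {suc n} A = sum λ j →
    (R.- R.1#) ^ toℕ j R.* (A zero j R.* det λ i k → A (suc i) (punchIn j k))

  Θ : (G : FiniteGroup a ℓ₁) → Func (FiniteGroup.setoid G) R.setoid → R.Carrier
  Θ G x = det λ i j → Func.to x (element i ∙ element j ⁻¹)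
    where open FiniteGroup G

S : FiniteGroup a ℓ → Pred ℤ (a ⊔ ℓ)
S G z = ∃ λ (x : Func (FiniteGroup.setoid G) (setoid ℤ)) →
  Θ ℤₚ.+-*-commutativeRing G x ≡ z

infix 8 _·ℤ

_·ℤ : ℕ → Pred ℤ 0ℓ
(m ·ℤ) z = + m ∣ z

-- Over ℤ[ζ] with ζ⁵ = 1, the determinant of x is the product of the values of x
-- at the 25 characters. Put π = 1 − ζ, so that 5 is a unit times π⁴. Modulo π
-- every value equals the augmentation of x, so if 5 divides the determinant,
-- then 5 divides the augmentation and π divides every value. Modulo π² the value
-- at the character (a , b) is −π (a s + b t), where s and t are the first
-- moments of x; this vanishes for at least 4 nontrivial characters. Altogether
-- π³² divides the determinant, that is, 5⁸ does.
--
-- Conversely, adding m times the sum of all group elements to x changes only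
-- the trivial value, which grows by 25 m. So it suffices to have elements
-- with augmentations 0, 5, 10, 15, 20 whose nontrivial values multiply to 5⁷.

module Submission where

open import Defs
open import Algebra.Bundles using (AbelianGroup; CommutativeRing)
import Algebra.Construct.DirectProduct as DirectProduct
import Algebra.Morphism.Construct.Composition as Composition
open import Algebra.Morphism.Structures using (module RingMorphisms)
import Algebra.Properties.CommutativeMonoid.Sum as Product
import Algebra.Properties.CommutativeSemigroup as CommSemigroupProperties
import Algebra.Properties.CommutativeSemigroup.Divisibility as CommSemigroupDivisibility
import Algebra.Properties.Ring as RingProperties
import Algebra.Properties.Semiring.Divisibility as Divisibility
import Algebra.Properties.Semiring.Exp as Exp
import Algebra.Properties.Semiring.Mult as Mult
import Algebra.Properties.Semiring.Sum as Sum
import Algebra.Solver.Ring.NaturalCoefficients.Default as Solver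
open import Data.Bool.Base using (if_then_else_)
open import Data.Fin.Base
  using (Fin; zero; suc; toℕ; fromℕ<; punchIn; combine; remQuot; _↑ˡ_; _↑ʳ_)
open import Data.Fin.Patterns using (0F; 1F; 2F; 3F; 4F)
open import Data.Fin.Permutation using (Permutation; permutation)
open import Data.Fin.Properties
  using (_≟_; all?; toℕ-fromℕ<; remQuot-combine; combine-remQuot;
         combine-injectiveˡ; combine-injectiveʳ)
open import Data.Integer.Base as ℤ using (ℤ; +_; 0ℤ; 1ℤ; -1ℤ; ∣_∣)
open import Data.Integer.DivMod using (_%ℕ_; _/ℕ_; n%ℕd<d; a≡a%ℕn+[a/ℕn]*n)
open import Data.Integer.Divisibility.Signed as ℤ∣ using (divides)
import Data.Integer.Properties as ℤ
open import Data.Integer.Solver using (module +-*-Solver)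
open import Data.Nat.Base as ℕ using (ℕ; zero; suc; NonZero)
import Data.Nat.Divisibility as ℕ
open import Data.Nat.DivMod using (_%_; _/_; m≡m%n+[m/n]*n; m%n<n)
open import Data.Nat.Primality using (prime?; euclidsLemma)
import Data.Nat.Properties as ℕ
open import Data.Product.Base using (_×_; _,_; proj₁; proj₂; uncurry; ∃)
open import Data.Product.Relation.Binary.Pointwise.NonDependent using (×-decidable)
open import Data.Sum.Base using ([_,_]′)
open import Data.Vec.Functional using (Vector; head; tail; insertAt; removeAt)
open import Function.Base using (_∘_)
open import Function.Bundles using (Func; Inverse)
open import Level using (Level; _⊔_)
open import Relation.Binary.Definitions using (Decidable)
open import Relation.Binary.PropositionalEquality as ≡ using (_≡_; _≢_)
import Relation.Binary.Reasoning.Setoid as ≈-Reasoning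
open import Relation.Nullary.Decidable using (Dec; yes; no; does; from-yes; from-no)
open import Relation.Nullary.Negation using (contradiction)
open import Relation.Unary using (_∩_; _≐_)

-- The values at characters lie in ℤ[ζ], while the determinant is an integer defined by Laplace
-- expansion. Both inclusions therefore rest on factoring the image of the determinant in ℤ[ζ]. The
-- character matrix turns the group matrix into the diagonal matrix of values, up to a factor 25²⁵;
-- as 25 is not a unit in ℤ[ζ], this factor is cancelled, not inverted. Multiplicativity of the
-- Laplace determinant comes from the uniqueness of alternating forms.
--
-- ℤ[ζ] is built as two quadratic extensions of ℤ. Its elements are quadruples of integers with
-- decidable equality, so each fact about ζ, π and 5 is settled by exhibiting elements and
-- computing.
--
-- The linear form a s + b t on pairs (a , b) over the field with 5 elements has a nonzero kernel,
-- hence at least 4 nonzero zeros. The nontrivial values thus contribute at least 24 + 4 = 28 = 4 ·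
-- 7 factors π, and the 5⁷ asked of the five elements is the least power that this bound allows.

private
  variable
    m n : ℕ
    a b c c₁ c₂ ℓ ℓ′ ℓ₁ ℓ₂ : Level

-- Determinants

module Determinant {c ℓ} (R : CommutativeRing c ℓ) where

  open import Data.Vec.Functional using (_∷_)
  open CommutativeRing R hiding (zero)
  open RingProperties ring
  open CommSemigroupProperties *-commutativeSemigroup
    using (x∙yz≈y∙xz; x∙yz≈xz∙y) renaming (interchange to *-interchange)
  open Sum semiring
  open Exp semiring using (_^_)
  open Product *-commutativeMonoid using () renaming (sum to ∏)
  open ≈-Reasoning setoid

  Matrix : ℕ → ℕ → Set c
  Matrix m n = Fin m → Vector Carrier n

  infix 4 _≋_ _≋ₘ_

  _≋_ : (u v : Vector Carrier n) → Set ℓ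
  u ≋ v = ∀ i → u i ≈ v i

  _≋ₘ_ : (A B : Matrix m n) → Set ℓ
  A ≋ₘ B = ∀ i → A i ≋ B i

  ∷-cong : ∀ {u v : Vector Carrier n} {A B : Matrix m n} →
           u ≋ v → A ≋ₘ B → (u ∷ A) ≋ₘ (v ∷ B)
  ∷-cong u≋v A≋B zero    = u≋v
  ∷-cong u≋v A≋B (suc i) = A≋B i

  ∷-η : (A : Matrix (suc m) n) → A ≋ₘ (head A ∷ tail A)
  ∷-η A zero    _ = refl
  ∷-η A (suc i) _ = refl

  δ : Matrix n n
  δ zero    zero    = 1#
  δ zero    (suc j) = 0#
  δ (suc i) zero    = 0#
  δ (suc i) (suc j) = δ i j

  -- Linear and alternating forms

  record IsLinear (L : Vector Carrier n → Carrier) : Set (c ⊔ ℓ) where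
    field
      cong   : ∀ {u v} → u ≋ v → L u ≈ L v
      +-homo : ∀ u v → L (λ i → u i + v i) ≈ L u + L v
      *-homo : ∀ a u → L (λ i → a * u i) ≈ a * L u

    0-homo : ∀ {u} → (∀ i → u i ≈ 0#) → L u ≈ 0#
    0-homo {u} u≈0 = begin
      L u                 ≈⟨ cong (λ i → trans (u≈0 i) (sym (zeroˡ _))) ⟩
      L (λ i → 0# * u i)  ≈⟨ *-homo 0# u ⟩
      0# * L u            ≈⟨ zeroˡ _ ⟩
      0#                  ∎

  open IsLinear

  sum-zero : ∀ {f : Vector Carrier n} → (∀ i → f i ≈ 0#) → sum f ≈ 0#
  sum-zero {n} f≈0 = trans (sum-cong-≋ f≈0) (sum-replicate-zero n)

  lookup-linear : ∀ i → IsLinear {n} (λ v → v i)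
  lookup-linear i = record { cong = λ u≋v → u≋v i ; +-homo = λ _ _ → refl ; *-homo = λ _ _ → refl }

  linear-sum : ∀ {k} {L : Fin k → Vector Carrier n → Carrier} (a : Vector Carrier k) →
               (∀ j → IsLinear (L j)) → IsLinear (λ v → ∑[ j < k ] (a j * L j v))
  linear-sum {k = k} {L} a lin = record
    { cong   = λ u≋v → sum-cong-≋ λ j → *-congˡ (cong (lin j) u≋v)
    ; +-homo = λ u v → trans
        (sum-cong-≋ λ j → trans (*-congˡ (+-homo (lin j) u v)) (distribˡ (a j) _ _))
        (∑-distrib-+ (λ j → a j * L j u) (λ j → a j * L j v))
    ; *-homo = λ b u → trans
        (sum-cong-≋ λ j → trans (*-congˡ (*-homo (lin j) b u)) (x∙yz≈y∙xz (a j) b _))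
        (sym (*-distribˡ-sum b (λ j → a j * L j u)))
    }

  linear-resp : ∀ {L M : Vector Carrier n → Carrier} →
                (∀ u → L u ≈ M u) → IsLinear L → IsLinear M
  linear-resp L≈M lin = record
    { cong   = λ u≋v → trans (sym (L≈M _)) (trans (cong lin u≋v) (L≈M _))
    ; +-homo = λ u v → trans (sym (L≈M _)) (trans (+-homo lin u v) (+-cong (L≈M u) (L≈M v)))
    ; *-homo = λ a u → trans (sym (L≈M _)) (trans (*-homo lin a u) (*-congˡ (L≈M u)))
    }

  linear-∘ : ∀ {T : Vector Carrier m → Vector Carrier n} {L} →
             (∀ i → IsLinear (λ v → T v i)) → IsLinear L → IsLinear (L ∘ T)
  linear-∘ T-lin lin = record
    { cong   = λ u≋v → cong lin λ i → cong (T-lin i) u≋v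
    ; +-homo = λ u v → trans (cong lin λ i → +-homo (T-lin i) u v) (+-homo lin _ _)
    ; *-homo = λ a u → trans (cong lin λ i → *-homo (T-lin i) a u) (*-homo lin a _)
    }

  -- Polarization: expand the vanishing value of `β` at `u + v` and `u + v`. The converse can fail
  -- where 2 is a zero divisor, so vanishing on equal rows, and not antisymmetry, is the axiom for
  -- forms below.
  bilinear-swap : (β : Vector Carrier n → Vector Carrier n → Carrier) →
                  (∀ v → IsLinear (λ u → β u v)) → (∀ u → IsLinear (β u)) →
                  (∀ u → β u u ≈ 0#) → ∀ u v → β u v ≈ - β v u
  bilinear-swap β linˡ linʳ β-alt u v = +-inverseˡ-unique _ _ (begin
    β u v + β v u
      ≈⟨ +-cong (+-identityˡ _) (+-identityʳ _) ⟨
    (0# + β u v) + (β v u + 0#)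
      ≈⟨ +-cong (+-congʳ (β-alt u)) (+-congˡ (β-alt v)) ⟨
    (β u u + β u v) + (β v u + β v v)
      ≈⟨ +-cong (+-homo (linʳ u) u v) (+-homo (linʳ v) u v) ⟨
    β u (λ i → u i + v i) + β v (λ i → u i + v i)
      ≈⟨ +-homo (linˡ _) u v ⟨
    β (λ i → u i + v i) (λ i → u i + v i)
      ≈⟨ β-alt _ ⟩
    0#
      ∎)

  linear-expand : ∀ {L : Vector Carrier n → Carrier} → IsLinear L →
                  ∀ u → L u ≈ ∑[ j < n ] (u j * L (δ j))
  linear-expand {zero}  lin u = 0-homo lin λ ()
  linear-expand {suc n} {L} lin u = begin
    L u
      ≈⟨ cong lin split ⟩
    L (λ i → u zero * δ zero i + (0# ∷ tail u) i)
      ≈⟨ +-homo lin _ _ ⟩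
    L (λ i → u zero * δ zero i) + L (0# ∷ tail u)
      ≈⟨ +-cong (*-homo lin (u zero) (δ zero)) (linear-expand tail-linear (tail u)) ⟩
    u zero * L (δ zero) + ∑[ j < n ] (u (suc j) * L (0# ∷ δ j))
      ≈⟨ +-congˡ (sum-cong-≋ λ j → *-congˡ {u (suc j)} (cong lin (0∷δ≋δ j))) ⟩
    u zero * L (δ zero) + ∑[ j < n ] (u (suc j) * L (δ (suc j)))
      ∎
    where
    0∷δ≋δ : ∀ j → (0# ∷ δ j) ≋ δ (suc j)
    0∷δ≋δ j zero    = refl
    0∷δ≋δ j (suc i) = refl

    split : u ≋ (λ i → u zero * δ zero i + (0# ∷ tail u) i)
    split zero    = sym (trans (+-identityʳ _) (*-identityʳ _))
    split (suc i) = sym (trans (+-congʳ (zeroʳ _)) (+-identityˡ _))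

    tail-linear : IsLinear (λ v → L (0# ∷ v))
    tail-linear = record
      { cong   = λ u≋v → cong lin λ { zero → refl ; (suc i) → u≋v i }
      ; +-homo = λ v w → trans
          (cong lin λ { zero → sym (+-identityˡ 0#) ; (suc i) → refl })
          (+-homo lin (0# ∷ v) (0# ∷ w))
      ; *-homo = λ a v → trans
          (cong lin λ { zero → sym (zeroʳ a) ; (suc i) → refl })
          (*-homo lin a (0# ∷ v))
      }

  -- The axioms speak of the first row only and pass to the others through the form left after
  -- fixing it; proofs then go by induction on the number of rows. This number is kept apart from
  -- the row length `n`, since fixing a row lowers the former and changing coordinates alters the
  -- latter.
  data IsAlternating {n} : ∀ {m} → (Matrix m n → Carrier) → Set (c ⊔ ℓ) where
    nullary : ∀ {D : Matrix 0 n → Carrier} →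
      (∀ {A B} → A ≋ₘ B → D A ≈ D B) →
      IsAlternating D
    suc-ary : ∀ {m} {D : Matrix (suc m) n → Carrier} →
      (∀ {A B} → A ≋ₘ B → D A ≈ D B) →
      (∀ B → IsLinear (λ v → D (v ∷ B))) →
      (∀ v → IsAlternating (λ B → D (v ∷ B))) →
      (∀ v B i → B i ≋ v → D (v ∷ B) ≈ 0#) →
      IsAlternating D

  form-cong : ∀ {D : Matrix m n → Carrier} → IsAlternating D →
              ∀ {A B} → A ≋ₘ B → D A ≈ D B
  form-cong (nullary D-cong)       = D-cong
  form-cong (suc-ary D-cong _ _ _) = D-cong

  form-linear : ∀ {D : Matrix (suc m) n → Carrier} → IsAlternating D →
                ∀ B → IsLinear (λ v → D (v ∷ B))
  form-linear (suc-ary _ D-lin _ _) = D-lin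

  form-tail : ∀ {D : Matrix (suc m) n → Carrier} → IsAlternating D →
              ∀ v → IsAlternating (λ B → D (v ∷ B))
  form-tail (suc-ary _ _ D-tail _) = D-tail

  form-alternates : ∀ {D : Matrix (suc m) n → Carrier} → IsAlternating D →
                    ∀ v B i → B i ≋ v → D (v ∷ B) ≈ 0#
  form-alternates (suc-ary _ _ _ D-alt) = D-alt

  alternating-resp : ∀ {D E : Matrix m n → Carrier} →
    (∀ A → D A ≈ E A) → IsAlternating D → IsAlternating E
  alternating-resp D≈E (nullary D-cong) =
    nullary λ A≋B → trans (sym (D≈E _)) (trans (D-cong A≋B) (D≈E _))
  alternating-resp D≈E (suc-ary D-cong D-lin D-tail D-alt) = suc-ary
    (λ A≋B → trans (sym (D≈E _)) (trans (D-cong A≋B) (D≈E _)))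
    (λ B → linear-resp (λ _ → D≈E _) (D-lin B))
    (λ v → alternating-resp (λ _ → D≈E _) (D-tail v))
    (λ v B i Bi≋v → trans (sym (D≈E _)) (D-alt v B i Bi≋v))

  -- Right multiplication of the argument by a matrix, without coordinates. The instances below
  -- insert a zero column, delete a column, or multiply by a given matrix.
  pullback : ∀ {k} {T : Vector Carrier k → Vector Carrier n} →
             (∀ i → IsLinear (λ v → T v i)) →
             ∀ {D : Matrix m n → Carrier} → IsAlternating D →
             IsAlternating (D ∘ (T ∘_))
  pullback lin (nullary D-cong) = nullary λ _ → D-cong λ ()
  pullback {T = T} lin {D} (suc-ary D-cong D-lin D-tail D-alt) = suc-ary
    (λ A≋B → D-cong λ i j → cong (lin j) (A≋B i))
    (λ B → linear-resp (λ _ → D-cong ∷-T) (linear-∘ lin (D-lin (T ∘ B))))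
    (λ v → alternating-resp (λ _ → D-cong ∷-T) (pullback lin (D-tail (T v))))
    (λ v B i Bi≋v → trans (sym (D-cong ∷-T)) (D-alt (T v) (T ∘ B) i λ j → cong (lin j) Bi≋v))
    where
    ∷-T : ∀ {u B} → (T u ∷ T ∘ B) ≋ₘ (T ∘ (u ∷ B))
    ∷-T zero    _ = refl
    ∷-T (suc i) _ = refl

  row-scale : ∀ {D : Matrix m n → Carrier} → IsAlternating D →
              ∀ (a : Vector Carrier m) (A : Matrix m n) →
              D (λ i j → a i * A i j) ≈ ∏ a * D A
  row-scale (nullary D-cong) a A = trans (D-cong λ ()) (sym (*-identityˡ _))
  row-scale {D = D} (suc-ary D-cong D-lin D-tail D-alt) a A = begin
    D (λ i j → a i * A i j)
      ≈⟨ D-cong (∷-η _) ⟩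
    D ((λ j → a zero * A zero j) ∷ (λ i j → a (suc i) * A (suc i) j))
      ≈⟨ *-homo (D-lin _) (a zero) (A zero) ⟩
    a zero * D (A zero ∷ (λ i j → a (suc i) * A (suc i) j))
      ≈⟨ *-congˡ (row-scale (D-tail (A zero)) (tail a) (tail A)) ⟩
    a zero * (∏ (tail a) * D (A zero ∷ tail A))
      ≈⟨ *-assoc _ _ _ ⟨
    ∏ a * D (A zero ∷ tail A)
      ≈⟨ *-congˡ (D-cong (∷-η A)) ⟨
    ∏ a * D A
      ∎

  swap : ∀ {D : Matrix (suc (suc m)) n → Carrier} → IsAlternating D →
         ∀ u v B → D (u ∷ v ∷ B) ≈ - D (v ∷ u ∷ B)
  swap {D = D} (suc-ary D-cong D-lin D-tail D-alt) u v B =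
    bilinear-swap (λ u v → D (u ∷ v ∷ B)) (λ v → D-lin (v ∷ B))
      (λ u → tail-linear (D-tail u)) (λ w → D-alt w (w ∷ B) zero λ _ → refl) u v
    where
    tail-linear : ∀ {E : Matrix (suc _) _ → Carrier} → IsAlternating E →
                  IsLinear (λ v → E (v ∷ B))
    tail-linear (suc-ary _ E-lin _ _) = E-lin B

  -- Here `D` is a form with some rows already fixed and `w` is one of them, so `D-zero` is an
  -- instance of alternation.
  add-multiple : ∀ {D : Matrix m n → Carrier} → IsAlternating D → ∀ w →
                 (∀ (B : Matrix m n) i → B i ≋ w → D B ≈ 0#) →
                 ∀ (a : Vector Carrier m) (A : Matrix m n) →
                 D (λ i j → A i j + a i * w j) ≈ D A
  add-multiple (nullary D-cong) w D-zero a A = D-cong λ ()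
  add-multiple {D = D} (suc-ary D-cong D-lin D-tail D-alt) w D-zero a A = begin
    D A′
      ≈⟨ D-cong (∷-η A′) ⟩
    D ((λ j → A zero j + a zero * w j) ∷ tail A′)
      ≈⟨ +-homo (D-lin (tail A′)) (A zero) (λ j → a zero * w j) ⟩
    D (A zero ∷ tail A′) + D ((λ j → a zero * w j) ∷ tail A′)
      ≈⟨ +-congˡ (*-homo (D-lin (tail A′)) (a zero) w) ⟩
    D (A zero ∷ tail A′) + a zero * D (w ∷ tail A′)
      ≈⟨ +-congˡ (trans (*-congˡ (D-zero _ zero (λ _ → refl))) (zeroʳ _)) ⟩
    D (A zero ∷ tail A′) + 0#
      ≈⟨ +-identityʳ _ ⟩
    D (A zero ∷ tail A′)
      ≈⟨ add-multiple (D-tail (A zero)) w (λ B i → D-zero (A zero ∷ B) (suc i)) (tail a) (tail A) ⟩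
    D (A zero ∷ tail A)
      ≈⟨ D-cong (∷-η A) ⟨
    D A
      ∎
    where A′ = λ i j → A i j + a i * w j

  0-insert : Fin (suc n) → Vector Carrier n → Vector Carrier (suc n)
  0-insert j v = insertAt v j 0#

  0-insert-linear : ∀ j i → IsLinear {n} (λ v → 0-insert j v i)
  0-insert-linear j i = record
    { cong   = 0-insert-cong j i
    ; +-homo = 0-insert-+ j i
    ; *-homo = 0-insert-* j i
    }
    where
    0-insert-cong : ∀ {n} j i {u v : Vector Carrier n} → u ≋ v → 0-insert j u i ≈ 0-insert j v i
    0-insert-cong         zero    zero    u≋v = refl
    0-insert-cong         zero    (suc i) u≋v = u≋v i
    0-insert-cong {suc n} (suc j) zero    u≋v = u≋v zero
    0-insert-cong {suc n} (suc j) (suc i) u≋v = 0-insert-cong j i (u≋v ∘ suc)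

    0-insert-+ : ∀ {n} j i (u v : Vector Carrier n) →
      0-insert j (λ k → u k + v k) i ≈ 0-insert j u i + 0-insert j v i
    0-insert-+         zero    zero    u v = sym (+-identityˡ 0#)
    0-insert-+         zero    (suc i) u v = refl
    0-insert-+ {suc n} (suc j) zero    u v = refl
    0-insert-+ {suc n} (suc j) (suc i) u v = 0-insert-+ j i (tail u) (tail v)

    0-insert-* : ∀ {n} j i a (u : Vector Carrier n) →
      0-insert j (λ k → a * u k) i ≈ a * 0-insert j u i
    0-insert-*         zero    zero    a u = sym (zeroʳ a)
    0-insert-*         zero    (suc i) a u = refl
    0-insert-* {suc n} (suc j) zero    a u = refl
    0-insert-* {suc n} (suc j) (suc i) a u = 0-insert-* j i a (tail u)

  0-insert-removeAt : ∀ (v : Vector Carrier (suc n)) j i →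
                      0-insert j (removeAt v j) i + v j * δ j i ≈ v i
  0-insert-removeAt         v zero    zero    = trans (+-identityˡ _) (*-identityʳ _)
  0-insert-removeAt         v zero    (suc i) = trans (+-congˡ (zeroʳ _)) (+-identityʳ _)
  0-insert-removeAt {suc n} v (suc j) zero    = trans (+-congˡ (zeroʳ _)) (+-identityʳ _)
  0-insert-removeAt {suc n} v (suc j) (suc i) = 0-insert-removeAt (tail v) j i

  -- The rows δ j, δ (punchIn j 0), δ (punchIn j 1), … come from the identity
  -- matrix by a cyclic permutation of the first j + 1 rows.
  cycle-sign : ∀ {D : Matrix (suc n) (suc n) → Carrier} → IsAlternating D →
               ∀ j → D (δ j ∷ 0-insert j ∘ δ) ≈ (- 1#) ^ toℕ j * D δ
  cycle-sign D-alt zero = trans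
    (form-cong D-alt λ { zero _ → refl ; (suc i) zero → refl ; (suc i) (suc j) → refl })
    (sym (*-identityˡ _))
  cycle-sign {suc n} {D} D-alt@(suc-ary _ _ D-tail _) (suc j) = begin
    D (δ (suc j) ∷ 0-insert (suc j) ∘ δ)
      ≈⟨ form-cong D-alt rows ⟩
    D ((0# ∷ δ j) ∷ δ zero ∷ (0# ∷_) ∘ 0-insert j ∘ δ)
      ≈⟨ swap D-alt _ _ _ ⟩
    - D (δ zero ∷ (0# ∷ δ j) ∷ (0# ∷_) ∘ 0-insert j ∘ δ)
      ≈⟨ -‿cong (form-cong D-alt rows′) ⟩
    - D (δ zero ∷ (0# ∷_) ∘ (δ j ∷ 0-insert j ∘ δ))
      ≈⟨ -‿cong (cycle-sign (pullback 0∷-linear (D-tail (δ zero))) j) ⟩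
    - ((- 1#) ^ toℕ j * D (δ zero ∷ (0# ∷_) ∘ δ))
      ≈⟨ -‿cong (*-congˡ (form-cong D-alt rows″)) ⟩
    - ((- 1#) ^ toℕ j * D δ)
      ≈⟨ -‿distribˡ-* _ _ ⟩
    - ((- 1#) ^ toℕ j) * D δ
      ≈⟨ *-congʳ (-1*x≈-x _) ⟨
    (- 1#) ^ toℕ (suc j) * D δ
      ∎
    where
    0∷-linear : ∀ i → IsLinear {suc n} (λ v → (0# ∷ v) i)
    0∷-linear zero    = record
      { cong = λ _ → refl ; +-homo = λ _ _ → sym (+-identityˡ 0#) ; *-homo = λ a _ → sym (zeroʳ a) }
    0∷-linear (suc i) = record
      { cong = λ u≋v → u≋v i ; +-homo = λ _ _ → refl ; *-homo = λ _ _ → refl }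

    rows : (δ (suc j) ∷ 0-insert (suc j) ∘ δ) ≋ₘ ((0# ∷ δ j) ∷ δ zero ∷ (0# ∷_) ∘ 0-insert j ∘ δ)
    rows zero          zero    = refl
    rows zero          (suc k) = refl
    rows (suc zero)    zero    = refl
    rows (suc zero)    (suc k) = 0-homo (0-insert-linear j k) (λ _ → refl)
    rows (suc (suc i)) zero    = refl
    rows (suc (suc i)) (suc k) = refl

    rows′ : (δ zero ∷ (0# ∷ δ j) ∷ (0# ∷_) ∘ 0-insert j ∘ δ) ≋ₘ
            (δ zero ∷ (0# ∷_) ∘ (δ j ∷ 0-insert j ∘ δ))
    rows′ zero          k = refl
    rows′ (suc zero)    k = refl
    rows′ (suc (suc i)) k = refl

    rows″ : (δ zero ∷ (0# ∷_) ∘ δ) ≋ₘ δ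
    rows″ zero    k       = refl
    rows″ (suc i) zero    = refl
    rows″ (suc i) (suc k) = refl

  -- Expand the first row in the basis `δ j`. Multiples of `δ j` clear column `j` from the remaining
  -- rows, which leaves an alternating form in the minor. By induction it is the determinant of the
  -- minor times a value of `D` at a permuted identity matrix, and `cycle-sign` supplies the sign of
  -- the Laplace expansion.
  alternating-unique : ∀ {D : Matrix n n → Carrier} → IsAlternating D →
                       ∀ A → D A ≈ det R A * D δ
  alternating-unique (nullary D-cong) A = trans (D-cong λ ()) (sym (*-identityˡ _))
  alternating-unique {suc n} {D} D-alternating@(suc-ary D-cong D-lin D-tail D-alt) A = begin
    D A
      ≈⟨ D-cong (∷-η A) ⟩
    D (head A ∷ tail A)
      ≈⟨ linear-expand (D-lin (tail A)) (head A) ⟩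
    ∑[ j < suc n ] (A zero j * D (δ j ∷ tail A))
      ≈⟨ sum-cong-≋ term ⟩
    ∑[ j < suc n ] ((- 1#) ^ toℕ j * (A zero j * det R (minor j)) * D δ)
      ≈⟨ *-distribʳ-sum (D δ) (λ j → (- 1#) ^ toℕ j * (A zero j * det R (minor j))) ⟨
    det R A * D δ
      ∎
    where
    minor : Fin (suc n) → Matrix n n
    minor j i k = A (suc i) (punchIn j k)

    clear : ∀ j → D (δ j ∷ tail A) ≈ D (δ j ∷ 0-insert j ∘ minor j)
    clear j = begin
      D (δ j ∷ tail A)
        ≈⟨ D-cong (∷-cong (λ _ → refl) λ i k → sym (0-insert-removeAt (A (suc i)) j k)) ⟩
      D (δ j ∷ (λ i k → 0-insert j (minor j i) k + A (suc i) j * δ j k))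
        ≈⟨ add-multiple (D-tail (δ j)) (δ j) (D-alt (δ j)) (λ i → A (suc i) j) _ ⟩
      D (δ j ∷ 0-insert j ∘ minor j)
        ∎

    term : ∀ j → A zero j * D (δ j ∷ tail A) ≈
                 (- 1#) ^ toℕ j * (A zero j * det R (minor j)) * D δ
    term j = begin
      A zero j * D (δ j ∷ tail A)
        ≈⟨ *-congˡ (clear j) ⟩
      A zero j * D (δ j ∷ 0-insert j ∘ minor j)
        ≈⟨ *-congˡ (alternating-unique (pullback (0-insert-linear j) (D-tail (δ j))) (minor j)) ⟩
      A zero j * (det R (minor j) * D (δ j ∷ 0-insert j ∘ δ))
        ≈⟨ *-congˡ (*-congˡ (cycle-sign D-alternating j)) ⟩
      A zero j * (det R (minor j) * ((- 1#) ^ toℕ j * D δ))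
        ≈⟨ *-assoc _ _ _ ⟨
      A zero j * det R (minor j) * ((- 1#) ^ toℕ j * D δ)
        ≈⟨ *-assoc _ _ _ ⟨
      A zero j * det R (minor j) * (- 1#) ^ toℕ j * D δ
        ≈⟨ *-congʳ (*-comm _ _) ⟩
      (- 1#) ^ toℕ j * (A zero j * det R (minor j)) * D δ
        ∎

  alternating-sum : ∀ {k} {D : Fin k → Matrix m n → Carrier} (a : Vector Carrier k) →
                    (∀ j → IsAlternating (D j)) →
                    IsAlternating (λ A → ∑[ j < k ] (a j * D j A))
  alternating-sum {zero}  a alt = nullary λ A≋B →
    sum-cong-≋ λ j → *-congˡ (form-cong (alt j) A≋B)
  alternating-sum {suc m} a alt = suc-ary
    (λ A≋B → sum-cong-≋ λ j → *-congˡ (form-cong (alt j) A≋B))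
    (λ B → linear-sum a λ j → form-linear (alt j) B)
    (λ v → alternating-sum a λ j → form-tail (alt j) v)
    (λ v B i Bi≋v → sum-zero λ j →
      trans (*-congˡ (form-alternates (alt j) v B i Bi≋v)) (zeroʳ (a j)))

  -- The terms for the ordered pairs of columns (j , punchIn j k) and their
  -- transposes cancel.
  double-expansion-zero : ∀ n
    (g : Fin (suc (suc n)) → Fin (suc (suc n)) → (Fin n → Fin (suc (suc n))) → Carrier) →
    (∀ {a b φ ψ} → (∀ l → φ l ≡ ψ l) → g a b φ ≈ g b a ψ) →
    ∑[ j < suc (suc n) ] ((- 1#) ^ toℕ j *
      ∑[ k < suc n ] ((- 1#) ^ toℕ k * g j (punchIn j k) (punchIn j ∘ punchIn k))) ≈ 0#
  double-expansion-zero n g g-sym = begin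
    1# * ∑[ k < suc n ] (s k * first k) +
    ∑[ j < suc n ] (- 1# * s j *
      (1# * g (suc j) zero (punchIn (suc j) ∘ suc) + ∑[ k < n ] (- 1# * s k * rest j k)))
      ≈⟨ +-cong (*-identityˡ _) (sum-cong-≋ λ j → term j) ⟩
    X + ∑[ j < suc n ] (- 1# * (s j * first j) + s j * ∑[ k < n ] (s k * rest j k))
      ≈⟨ +-congˡ (∑-distrib-+ (λ j → - 1# * (s j * first j))
           (λ j → s j * ∑[ k < n ] (s k * rest j k))) ⟩
    X + (∑[ j < suc n ] (- 1# * (s j * first j)) +
         ∑[ j < suc n ] (s j * ∑[ k < n ] (s k * rest j k)))
      ≈⟨ +-congˡ (+-cong
           (trans (sym (*-distribˡ-sum (- 1#) λ j → s j * first j)) (-1*x≈-x X))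
           (rest-zero n g g-sym)) ⟩
    X + (- X + 0#)
      ≈⟨ +-congˡ (+-identityʳ _) ⟩
    X + - X
      ≈⟨ -‿inverseʳ X ⟩
    0#
      ∎
    where
    s : ∀ {m} → Fin m → Carrier
    s j = (- 1#) ^ toℕ j

    first : Fin (suc n) → Carrier
    first k = g zero (suc k) (suc ∘ punchIn k)

    X = ∑[ k < suc n ] (s k * first k)

    rest : Fin (suc n) → Fin n → Carrier
    rest j k = g (suc j) (suc (punchIn j k)) (punchIn (suc j) ∘ punchIn (suc k))

    term : ∀ j → - 1# * s j *
      (1# * g (suc j) zero (punchIn (suc j) ∘ suc) + ∑[ k < n ] (- 1# * s k * rest j k)) ≈
      - 1# * (s j * first j) + s j * ∑[ k < n ] (s k * rest j k)
    term j = begin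
      - 1# * s j *
      (1# * g (suc j) zero (punchIn (suc j) ∘ suc) + ∑[ k < n ] (- 1# * s k * rest j k))
        ≈⟨ *-congˡ (+-cong (trans (*-identityˡ _) (g-sym λ _ → ≡.refl))
             (trans (sum-cong-≋ λ k → *-assoc (- 1#) (s k) (rest j k))
                    (sym (*-distribˡ-sum (- 1#) λ k → s k * rest j k)))) ⟩
      - 1# * s j * (first j + - 1# * Y)
        ≈⟨ distribˡ _ _ _ ⟩
      - 1# * s j * first j + - 1# * s j * (- 1# * Y)
        ≈⟨ +-cong (*-assoc _ _ _) (*-interchange (- 1#) (s j) (- 1#) Y) ⟩
      - 1# * (s j * first j) + - 1# * - 1# * (s j * Y)
        ≈⟨ +-congˡ (trans (*-congʳ (trans (-1*x≈-x _) (-‿involutive 1#))) (*-identityˡ _)) ⟩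
      - 1# * (s j * first j) + s j * Y
        ∎
      where Y = ∑[ k < n ] (s k * rest j k)

    rest-zero : ∀ n
      (g : Fin (suc (suc n)) → Fin (suc (suc n)) → (Fin n → Fin (suc (suc n))) → Carrier) →
      (∀ {a b φ ψ} → (∀ l → φ l ≡ ψ l) → g a b φ ≈ g b a ψ) →
      ∑[ j < suc n ] ((- 1#) ^ toℕ j * ∑[ k < n ] ((- 1#) ^ toℕ k *
        g (suc j) (suc (punchIn j k)) (punchIn (suc j) ∘ punchIn (suc k)))) ≈ 0#
    rest-zero zero    g g-sym = sum-zero {f = λ (j : Fin 1) → s j * 0#} λ j → zeroʳ (s j)
    rest-zero (suc n) g g-sym = trans
      (sum-cong-≋ {suc (suc n)} λ j → *-congˡ {s j}
        (sum-cong-≋ {suc n} λ k → *-congˡ {s k}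
          (g-cong {suc j} {suc (punchIn j k)} (punchIn-suc j k))))
      -- When both chosen columns are nonzero, column 0 stays in every minor: this is a double
      -- expansion with one column fewer, with column 0 put back in front of each selection `φ`.
      (double-expansion-zero n (λ a b φ → g (suc a) (suc b) (zero ∷ suc ∘ φ))
        (λ φ≗ψ → g-sym λ { zero → ≡.refl ; (suc l) → ≡.cong suc (φ≗ψ l) }))
      where
      punchIn-suc : ∀ j k l → punchIn (suc j) (punchIn (suc k) l) ≡
                              (zero ∷ suc ∘ punchIn j ∘ punchIn k) l
      punchIn-suc j k zero    = ≡.refl
      punchIn-suc j k (suc l) = ≡.refl

      g-cong : ∀ {a b φ ψ} → (∀ l → φ l ≡ ψ l) → g a b φ ≈ g a b ψ
      g-cong φ≗ψ = trans (g-sym φ≗ψ) (g-sym λ _ → ≡.refl)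

  det-cong : ∀ {A B : Matrix n n} → A ≋ₘ B → det R A ≈ det R B
  det-cong {zero}  A≋B = refl
  det-cong {suc n} A≋B = sum-cong-≋ λ j → *-congˡ {(- 1#) ^ toℕ j}
    (*-cong (A≋B zero j) (det-cong λ i k → A≋B (suc i) (punchIn j k)))

  -- Expanding along both copies of `v` gives the summand `v a * v b * E φ`, symmetric in the two
  -- columns, whereas the signs are antisymmetric.
  repeated-first-row : ∀ (v : Vector Carrier (suc (suc n))) B → det R (v ∷ v ∷ B) ≈ 0#
  repeated-first-row {n} v B = trans
    (sum-cong-≋ {suc (suc n)} λ j → *-congˡ {s j} (trans
      (*-distribˡ-sum (v j) (λ k → s k * (v (punchIn j k) * E (punchIn j ∘ punchIn k))))
      (sum-cong-≋ {suc n} λ k → trans (x∙yz≈y∙xz (v j) (s k) _)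
        (*-congˡ {s k} (sym (*-assoc (v j) (v (punchIn j k)) (E (punchIn j ∘ punchIn k))))))))
    (double-expansion-zero n (λ a b φ → v a * v b * E φ)
      (λ φ≗ψ → *-cong (*-comm _ _) (det-cong λ i l → reflexive (≡.cong (B i) (φ≗ψ l)))))
    where
    s : ∀ {m} → Fin m → Carrier
    s j = (- 1#) ^ toℕ j

    E : (Fin n → Fin (suc (suc n))) → Carrier
    E φ = det R λ i l → B i (φ l)

  det-alternating : ∀ n → IsAlternating (det R {n})
  det-alternating zero    = nullary λ _ → refl
  det-alternating (suc n) = suc-ary det-cong first-linear tail-alternating first-alternates
    where
    minor : Matrix n (suc n) → Fin (suc n) → Carrier
    minor B j = det R λ i k → B i (punchIn j k)

    first-linear : ∀ B → IsLinear (λ v → det R (v ∷ B))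
    first-linear B = linear-resp
      (λ v → sum-cong-≋ λ j → sym (x∙yz≈xz∙y ((- 1#) ^ toℕ j) (v j) (minor B j)))
      (linear-sum (λ j → (- 1#) ^ toℕ j * minor B j) lookup-linear)

    tail-alternating : ∀ v → IsAlternating (λ B → det R (v ∷ B))
    tail-alternating v = alternating-resp
      (λ B → sum-cong-≋ λ j → *-assoc ((- 1#) ^ toℕ j) (v j) (minor B j))
      (alternating-sum (λ j → (- 1#) ^ toℕ j * v j)
        (λ j → pullback (λ k → lookup-linear (punchIn j k)) (det-alternating n)))

    first-alternates : ∀ v B i → B i ≋ v → det R (v ∷ B) ≈ 0#
    first-alternates v B zero    B₀≋v = trans
      (det-cong {A = v ∷ B} {v ∷ v ∷ tail B}
        λ { zero _ → refl ; (suc zero) → B₀≋v ; (suc (suc i)) _ → refl })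
      (repeated-first-row v (tail B))
    -- Exchanging the first two rows puts `v` below `head B`; the coincidence then lies within a
    -- minor, where the induction on the size applies.
    first-alternates v B (suc i) Bᵢ≋v = begin
      det R (v ∷ B)
        ≈⟨ det-cong (∷-cong {u = v} (λ _ → refl) (∷-η B)) ⟩
      det R (v ∷ head B ∷ tail B)
        ≈⟨ bilinear-swap (λ u w → det R (u ∷ w ∷ tail B))
             (λ w → first-linear (w ∷ tail B)) (λ u → form-linear (tail-alternating u) (tail B))
             (λ u → repeated-first-row u (tail B)) v (head B) ⟩
      - det R (head B ∷ v ∷ tail B)
        ≈⟨ -‿cong (form-alternates (tail-alternating (head B)) v (tail B) i Bᵢ≋v) ⟩
      - 0#
        ≈⟨ -0#≈0# ⟩
      0#
        ∎

  infixl 7 _⊗_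

  _⊗_ : ∀ {k} → Matrix m n → Matrix n k → Matrix m k
  _⊗_ {n = n} A B i k = ∑[ j < n ] (A i j * B j k)

  δ-sum : ∀ i (f : Vector Carrier n) → ∑[ j < n ] (δ i j * f j) ≈ f i
  δ-sum {suc n} zero    f = trans
    (+-cong (*-identityˡ _) (sum-zero λ j → zeroˡ (f (suc j)))) (+-identityʳ _)
  δ-sum {suc n} (suc i) f = trans (+-cong (zeroˡ _) (δ-sum i (tail f))) (+-identityˡ _)

  -- For fixed `B`, the map sending `A` to `det R (A ⊗ B)` is alternating in the rows of `A`, and
  -- its value at the identity is `det R B`.
  det-⊗ : ∀ (A B : Matrix n n) → det R (A ⊗ B) ≈ det R A * det R B
  det-⊗ {n} A B = trans
    (alternating-unique (pullback row-linear (det-alternating n)) A)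
    (*-congˡ (det-cong λ i k → δ-sum i (λ j → B j k)))
    where
    row-linear : ∀ k → IsLinear (λ v → ∑[ j < n ] (v j * B j k))
    row-linear k = linear-resp (λ v → sum-cong-≋ λ j → *-comm (B j k) (v j))
      (linear-sum (λ j → B j k) lookup-linear)

  det-row-scale : ∀ (a : Vector Carrier n) A → det R (λ i j → a i * A i j) ≈ ∏ a * det R A
  det-row-scale a A = row-scale (det-alternating _) a A

  det-δ : ∀ n → det R (δ {n}) ≈ 1#
  det-δ zero    = refl
  det-δ (suc n) = begin
    1# * (1# * det R (δ {n})) + ∑[ j < n ] ((- 1#) ^ suc (toℕ j) * (0# * det R (minor j)))
      ≈⟨ +-cong (trans (*-identityˡ _) (*-identityˡ _))
           (sum-zero λ j → trans
             (*-congˡ {(- 1#) ^ suc (toℕ j)} (zeroˡ (det R (minor j)))) (zeroʳ _)) ⟩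
    det R (δ {n}) + 0#
      ≈⟨ trans (+-identityʳ _) (det-δ n) ⟩
    1#
      ∎
    where
    minor : Fin n → Matrix n n
    minor j i k = δ (suc i) (punchIn (suc j) k)

-- Determinants under ring homomorphisms

module _ (R₁ : CommutativeRing c₁ ℓ₁) (R₂ : CommutativeRing c₂ ℓ₂) where

  private
    module R₁ = CommutativeRing R₁
    module R₂ = CommutativeRing R₂
    module Σ₁ = Sum R₁.semiring
    module Σ₂ = Sum R₂.semiring
    module ^₁ = Exp R₁.semiring
    module ^₂ = Exp R₂.semiring

  open R₂ using (_≈_; trans; *-cong; *-congˡ)
  open RingMorphisms R₁.rawRing R₂.rawRing

  module Homomorphism {h : R₁.Carrier → R₂.Carrier} (isHom : IsRingHomomorphism h) where

    open IsRingHomomorphism isHom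

    sum-homo : (f : Vector R₁.Carrier n) → h (Σ₁.sum f) ≈ Σ₂.sum (h ∘ f)
    sum-homo {zero}  f = 0#-homo
    sum-homo {suc n} f = trans (+-homo _ _) (R₂.+-congˡ (sum-homo (tail f)))

    ^-homo : ∀ x n → h (x ^₁.^ n) ≈ h x ^₂.^ n
    ^-homo x zero    = 1#-homo
    ^-homo x (suc n) = trans (*-homo _ _) (*-congˡ (^-homo x n))

    det-homo : (A : Fin n → Vector R₁.Carrier n) →
               h (det R₁ A) ≈ det R₂ (λ i j → h (A i j))
    det-homo {zero}  A = 1#-homo
    det-homo {suc n} A = trans
      (sum-homo λ j → (R₁.- R₁.1#) ^₁.^ toℕ j R₁.* (A zero j R₁.* det R₁ (minor j)))
      (Σ₂.sum-cong-≋ term)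
      where
      minor : Fin (suc n) → Fin n → Fin n → R₁.Carrier
      minor j i k = A (suc i) (punchIn j k)

      term : ∀ j → h ((R₁.- R₁.1#) ^₁.^ toℕ j R₁.* (A zero j R₁.* det R₁ (minor j))) ≈
                   (R₂.- R₂.1#) ^₂.^ toℕ j R₂.* (h (A zero j) R₂.* det R₂ (λ i k → h (minor j i k)))
      term j = trans (*-homo _ _) (*-cong
        (trans (^-homo _ (toℕ j)) (^₂.^-congˡ (toℕ j) (trans (-‿homo _) (R₂.-‿cong 1#-homo))))
        (trans (*-homo _ _) (*-congˡ (det-homo (minor j)))))

    Θ-homo : (G : FiniteGroup a ℓ) (x : Func (FiniteGroup.setoid G) R₁.setoid) →
             h (Θ R₁ G x) ≈ Θ R₂ G (record { to = h ∘ Func.to x ; cong = ⟦⟧-cong ∘ Func.cong x })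
    Θ-homo G x = det-homo λ i j → Func.to x (element i ∙ element j ⁻¹)
      where open FiniteGroup G

-- Characters and the group determinant

module _ (G : FiniteGroup a ℓ) where

  private module G = FiniteGroup G
  open Inverse G.enumeration using (to; from; inverseˡ; inverseʳ)

  translation : G.Carrier → Permutation G.order G.order
  translation h = permutation (shift h) (shift (h G.⁻¹))
    (shift-shift (G.inverseˡ h)) (shift-shift (G.inverseʳ h))
    where
    open ≈-Reasoning G.setoid

    shift : G.Carrier → Fin G.order → Fin G.order
    shift h i = from (to i G.∙ h)

    shift-shift : ∀ {g h} → g G.∙ h G.≈ G.ε → ∀ i → shift h (shift g i) ≡ i
    shift-shift {g} {h} gh≈ε i = inverseʳ (begin
      to (shift g i) G.∙ h  ≈⟨ G.∙-congʳ (inverseˡ ≡.refl) ⟩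
      (to i G.∙ g) G.∙ h    ≈⟨ G.assoc _ _ _ ⟩
      to i G.∙ (g G.∙ h)    ≈⟨ G.∙-congˡ gh≈ε ⟩
      to i G.∙ G.ε          ≈⟨ G.identityʳ _ ⟩
      to i                  ∎)

module DedekindFactorization {c ℓ} (R : CommutativeRing c ℓ) where

  open CommutativeRing R hiding (zero)
  open Determinant R
  open Sum semiring
  open Mult semiring using (×1-homo-*) renaming (_×_ to _·_)
  open Exp semiring using (_^_)
  open Product *-commutativeMonoid using ()
    renaming (sum to ∏; sum-replicate to ∏-replicate)
  open CommSemigroupProperties *-commutativeSemigroup
    using (x∙yz≈y∙xz; x∙yz≈z∙xy) renaming (interchange to *-interchange)
  open ≈-Reasoning setoid

  -- A full set of characters, one for each group element. Evaluation at the inverse stands in for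
  -- complex conjugation. Orthogonality is an axiom because over a ring with zero divisors distinct
  -- characters may fail to be orthogonal.
  record Characters (G : FiniteGroup a ℓ′) : Set (c ⊔ ℓ ⊔ a ⊔ ℓ′) where
    private module G = FiniteGroup G
    field
      χ          : Fin G.order → G.Carrier → Carrier
      χ-cong     : ∀ k {g h} → g G.≈ h → χ k g ≈ χ k h
      χ-homo     : ∀ k g h → χ k (g G.∙ h) ≈ χ k g * χ k h
      orthogonal : ∀ k l → ∑[ i < G.order ] (χ k (G.element i) * χ l (G.element i G.⁻¹)) ≈
                           (G.order · 1#) * δ k l

  module _ (G : FiniteGroup a ℓ′) where

    private module G = FiniteGroup G

    ∑-translate : (f : G.Carrier → Carrier) → (∀ {g h} → g G.≈ h → f g ≈ f h) → ∀ h →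
                  ∑[ i < G.order ] f (G.element i G.∙ h) ≈ ∑[ i < G.order ] f (G.element i)
    ∑-translate f f-cong h = sym (trans
      (sum-permute (f ∘ G.element) (translation G h))
      (sum-cong-≋ {G.order} λ i → f-cong (Inverse.inverseˡ G.enumeration ≡.refl)))

    -- With `A` the character matrix, `A ⊗ M` is the diagonal matrix of values times `A`, and
    -- `A ⊗ B` is `N` times the identity. Multiplying by `det R B` turns the stray `det R A` on both
    -- sides into `N ^ G.order`, which is kept because `R` is arbitrary here.
    dedekind : (X : Characters G) (x : Func G.setoid setoid) → let open Characters X in
               (G.order · 1#) ^ G.order * Θ R G x ≈
               (G.order · 1#) ^ G.order *
                 ∏ (λ k → ∑[ i < G.order ] (Func.to x (G.element i) * χ k (G.element i)))
    dedekind X x = begin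
      N ^ G.order * det R M
        ≈⟨ *-congʳ det-AB ⟨
      det R A * det R B * det R M
        ≈⟨ *-assoc _ _ _ ⟩
      det R A * (det R B * det R M)
        ≈⟨ x∙yz≈y∙xz _ _ _ ⟩
      det R B * (det R A * det R M)
        ≈⟨ *-congˡ (det-⊗ A M) ⟨
      det R B * det R (A ⊗ M)
        ≈⟨ *-congˡ (det-cong eigenvector) ⟩
      det R B * det R (λ k j → value k * A k j)
        ≈⟨ *-congˡ (det-row-scale value A) ⟩
      det R B * (∏ value * det R A)
        ≈⟨ x∙yz≈z∙xy (det R B) (∏ value) (det R A) ⟩
      det R A * (det R B * ∏ value)
        ≈⟨ *-assoc _ _ _ ⟨
      det R A * det R B * ∏ value
        ≈⟨ *-congʳ det-AB ⟩
      N ^ G.order * ∏ value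
        ∎
      where
      open Characters X
      open Func x using () renaming (to to ⟨x⟩; cong to x-cong)

      N = G.order · 1#

      A B M : Matrix G.order G.order
      A k i = χ k (G.element i)
      B i k = χ k (G.element i G.⁻¹)
      M i j = ⟨x⟩ (G.element i G.∙ G.element j G.⁻¹)

      value : Vector Carrier G.order
      value k = ∑[ i < G.order ] (⟨x⟩ (G.element i) * χ k (G.element i))

      eigenvector : (A ⊗ M) ≋ₘ (λ k j → value k * A k j)
      eigenvector k j = begin
        ∑[ i < G.order ] (χ k (G.element i) * ⟨x⟩ (G.element i G.∙ h G.⁻¹))
          ≈⟨ sum-cong-≋ {G.order} (λ i → trans (*-congʳ (χ-cong k (cancel i))) (*-comm _ _)) ⟩
        ∑[ i < G.order ] f (G.element i G.∙ h G.⁻¹)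
          ≈⟨ ∑-translate f (λ g≈h → *-cong (x-cong g≈h) (χ-cong k (G.∙-congʳ g≈h))) (h G.⁻¹) ⟩
        ∑[ i < G.order ] f (G.element i)
          ≈⟨ sum-cong-≋ {G.order} (λ i →
               trans (*-congˡ (χ-homo k (G.element i) h)) (sym (*-assoc _ _ _))) ⟩
        ∑[ i < G.order ] (⟨x⟩ (G.element i) * χ k (G.element i) * χ k h)
          ≈⟨ *-distribʳ-sum (χ k h) (λ i → ⟨x⟩ (G.element i) * χ k (G.element i)) ⟨
        value k * χ k h
          ∎
        where
        h = G.element j

        f : G.Carrier → Carrier
        f g = ⟨x⟩ g * χ k (g G.∙ h)

        cancel : ∀ i → G.element i G.≈ (G.element i G.∙ h G.⁻¹) G.∙ h
        cancel i = G.sym (G.trans (G.assoc _ _ _)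
          (G.trans (G.∙-congˡ (G.inverseˡ h)) (G.identityʳ _)))

      det-AB : det R A * det R B ≈ N ^ G.order
      det-AB = begin
        det R A * det R B
          ≈⟨ det-⊗ A B ⟨
        det R (A ⊗ B)
          ≈⟨ det-cong orthogonal ⟩
        det R {G.order} (λ k l → N * δ k l)
          ≈⟨ det-row-scale {G.order} (λ _ → N) δ ⟩
        ∏ {G.order} (λ _ → N) * det R (δ {G.order})
          ≈⟨ *-cong (∏-replicate G.order) (det-δ G.order) ⟩
        N ^ G.order * 1#
          ≈⟨ *-identityʳ _ ⟩
        N ^ G.order
          ∎

  ^-cancel : ∀ {x} → (∀ {u v} → x * u ≈ x * v → u ≈ v) →
             ∀ n {u v} → x ^ n * u ≈ x ^ n * v → u ≈ v
  ^-cancel x-cancel zero    eq = trans (sym (*-identityˡ _)) (trans eq (*-identityˡ _))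
  ^-cancel x-cancel (suc n) eq = ^-cancel x-cancel n (x-cancel
    (trans (sym (*-assoc _ _ _)) (trans eq (*-assoc _ _ _))))

  module _ (R₀ : CommutativeRing c₁ ℓ₁) {h : CommutativeRing.Carrier R₀ → Carrier}
           (isHom : RingMorphisms.IsRingHomomorphism (CommutativeRing.rawRing R₀) rawRing h) where

    Θ-factors : (G : FiniteGroup a ℓ′) (X : Characters G) →
                let open FiniteGroup G using (order; element)
                    open Characters X using (χ) in
                (∀ {u v} → (order · 1#) * u ≈ (order · 1#) * v → u ≈ v) →
                (x : Func (FiniteGroup.setoid G) (CommutativeRing.setoid R₀)) →
                h (Θ R₀ G x) ≈
                ∏ (λ k → ∑[ i < order ] (h (Func.to x (element i)) * χ k (element i)))
    Θ-factors G X order-cancel x = trans (Homomorphism.Θ-homo R₀ R isHom G x)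
      (^-cancel order-cancel (FiniteGroup.order G) (dedekind G X (record
        { to = h ∘ Func.to x ; cong = ⟦⟧-cong ∘ Func.cong x })))
      where open RingMorphisms.IsRingHomomorphism isHom using (⟦⟧-cong)

  ∑-+ : ∀ m n (f : Vector Carrier (m ℕ.+ n)) →
        sum f ≈ ∑[ i < m ] f (i ↑ˡ n) + ∑[ j < n ] f (m ↑ʳ j)
  ∑-+ zero    n f = sym (+-identityˡ _)
  ∑-+ (suc m) n f = trans (+-congˡ (∑-+ m n (tail f))) (sym (+-assoc _ _ _))

  ∑-combine : ∀ m n (f : Vector Carrier (m ℕ.* n)) →
              sum f ≈ ∑[ i < m ] ∑[ j < n ] f (combine i j)
  ∑-combine zero    n f = refl
  ∑-combine (suc m) n f = trans (∑-+ n (m ℕ.* n) f) (+-congˡ (∑-combine m n (f ∘ (n ↑ʳ_))))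

  ∑-remQuot : ∀ m n (f : Fin m → Fin n → Carrier) →
              ∑[ k < m ℕ.* n ] uncurry f (remQuot n k) ≈ ∑[ i < m ] ∑[ j < n ] f i j
  ∑-remQuot m n f = trans (∑-combine m n _)
    (sum-cong-≋ {m} λ i → sum-cong-≋ {n} λ j → reflexive (≡.cong (uncurry f) (remQuot-combine i j)))

  ∑-*-∑ : (f : Vector Carrier m) (g : Vector Carrier n) →
          ∑[ i < m ] ∑[ j < n ] (f i * g j) ≈ sum f * sum g
  ∑-*-∑ f g = trans
    (sum-cong-≋ λ i → sym (*-distribˡ-sum (f i) g)) (sym (*-distribʳ-sum (sum g) f))

  δ-≡ : ∀ (k : Fin n) → δ k k ≈ 1#
  δ-≡ zero    = refl
  δ-≡ (suc k) = δ-≡ k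

  δ-≢ : ∀ {k l : Fin n} → k ≢ l → δ k l ≈ 0#
  δ-≢ {k = zero}  {zero}  k≢l = contradiction ≡.refl k≢l
  δ-≢ {k = zero}  {suc l} k≢l = refl
  δ-≢ {k = suc k} {zero}  k≢l = refl
  δ-≢ {k = suc k} {suc l} k≢l = δ-≢ (k≢l ∘ ≡.cong suc)

  δ-combine : ∀ (i i′ : Fin m) (j j′ : Fin n) →
              δ (combine i j) (combine i′ j′) ≈ δ i i′ * δ j j′
  δ-combine i i′ j j′ with i ≟ i′ | j ≟ j′
  ... | yes ≡.refl | yes ≡.refl =
    trans (δ-≡ (combine i j)) (sym (trans (*-cong (δ-≡ i) (δ-≡ j)) (*-identityˡ _)))
  ... | no i≢i′    | _          =
    trans (δ-≢ (i≢i′ ∘ combine-injectiveˡ i j i′ j′)) (sym (trans (*-congʳ (δ-≢ i≢i′)) (zeroˡ _)))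
  ... | yes _      | no j≢j′    =
    trans (δ-≢ (j≢j′ ∘ combine-injectiveʳ i j i′ j′)) (sym (trans (*-congˡ (δ-≢ j≢j′)) (zeroʳ _)))

  δ-remQuot : ∀ m n (k l : Fin (m ℕ.* n)) → let (k₁ , k₂) = remQuot {m} n k
                                                (l₁ , l₂) = remQuot {m} n l in
              δ k l ≈ δ k₁ l₁ * δ k₂ l₂
  δ-remQuot m n k l = trans
    (reflexive (≡.cong₂ δ (≡.sym (combine-remQuot {m} n k)) (≡.sym (combine-remQuot {m} n l))))
    (δ-combine {m} _ _ _ _)

  _×ᶜ_ : ∀ {G : FiniteGroup a ℓ₁} {H : FiniteGroup b ℓ₂} →
         Characters G → Characters H → Characters (G ×ᴳ H)
  _×ᶜ_ {G = G} {H} X Y = record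
    { χ          = λ k (g , h) → let (k₁ , k₂) = remQuot {G.order} H.order k in
        X.χ k₁ g * Y.χ k₂ h
    ; χ-cong     = λ k (g≈ , h≈) → *-cong (X.χ-cong _ g≈) (Y.χ-cong _ h≈)
    ; χ-homo     = λ k (g , h) (g′ , h′) → trans
        (*-cong (X.χ-homo _ g g′) (Y.χ-homo _ h h′)) (*-interchange _ _ _ _)
    ; orthogonal = orthogonal
    }
    where
    module G = FiniteGroup G
    module H = FiniteGroup H
    module X = Characters X
    module Y = Characters Y

    orthogonal : ∀ k l → let (k₁ , k₂) = remQuot {G.order} H.order k
                             (l₁ , l₂) = remQuot {G.order} H.order l in
      ∑[ i < G.order ℕ.* H.order ] uncurry
        (λ i j → X.χ k₁ (G.element i) * Y.χ k₂ (H.element j) *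
                 (X.χ l₁ (G.element i G.⁻¹) * Y.χ l₂ (H.element j H.⁻¹)))
        (remQuot {G.order} H.order i) ≈
      ((G.order ℕ.* H.order) · 1#) * δ k l
    orthogonal k l = let (k₁ , k₂) = remQuot {G.order} H.order k
                         (l₁ , l₂) = remQuot {G.order} H.order l
                         f  = λ i → X.χ k₁ (G.element i)
                         f′ = λ i → X.χ l₁ (G.element i G.⁻¹)
                         g  = λ j → Y.χ k₂ (H.element j)
                         g′ = λ j → Y.χ l₂ (H.element j H.⁻¹) in begin
      ∑[ i < G.order ℕ.* H.order ]
        uncurry (λ i j → f i * g j * (f′ i * g′ j)) (remQuot {G.order} H.order i)
        ≈⟨ ∑-remQuot G.order H.order (λ i j → f i * g j * (f′ i * g′ j)) ⟩
      ∑[ i < G.order ] ∑[ j < H.order ] (f i * g j * (f′ i * g′ j))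
        ≈⟨ sum-cong-≋ {G.order} (λ i → sum-cong-≋ {H.order} λ j → *-interchange _ _ _ _) ⟩
      ∑[ i < G.order ] ∑[ j < H.order ] (f i * f′ i * (g j * g′ j))
        ≈⟨ ∑-*-∑ (λ i → f i * f′ i) (λ j → g j * g′ j) ⟩
      ∑[ i < G.order ] (f i * f′ i) * ∑[ j < H.order ] (g j * g′ j)
        ≈⟨ *-cong (X.orthogonal k₁ l₁) (Y.orthogonal k₂ l₂) ⟩
      (G.order · 1#) * δ k₁ l₁ * ((H.order · 1#) * δ k₂ l₂)
        ≈⟨ *-interchange _ _ _ _ ⟩
      (G.order · 1#) * (H.order · 1#) * (δ k₁ l₁ * δ k₂ l₂)
        ≈⟨ *-cong (×1-homo-* G.order H.order) (δ-remQuot G.order H.order k l) ⟨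
      ((G.order ℕ.* H.order) · 1#) * δ k l
        ∎

-- Quadratic extensions

module Quadratic {c ℓ} (R : CommutativeRing c ℓ) (p q : CommutativeRing.Carrier R) where

  private
    module R = CommutativeRing R
    module S = Solver R.commutativeSemiring
    module + = AbelianGroup (DirectProduct.abelianGroup R.+-abelianGroup R.+-abelianGroup)
  open R using (_+_; _*_; 0#; 1#; _≈_)

  infixl 7 _*′_

  _*′_ : R.Carrier × R.Carrier → R.Carrier × R.Carrier → R.Carrier × R.Carrier
  (a , b) *′ (c , d) = a * c + q * (b * d) , a * d + b * c + p * (b * d)

  -- R [ t ] / (t² − p t − q), with a + b t represented by (a , b).
  extension : CommutativeRing c ℓ
  extension = record
    { Carrier = R.Carrier × R.Carrier
    ; _≈_     = +._≈_
    ; _+_     = +._∙_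
    ; _*_     = _*′_
    ; -_      = +._⁻¹
    ; 0#      = +.ε
    ; 1#      = 1# , 0#
    ; isCommutativeRing = record
      { isRing = record
        { +-isAbelianGroup = +.isAbelianGroup
        ; *-cong     = λ (a≈ , b≈) (c≈ , d≈) →
            R.+-cong (R.*-cong a≈ c≈) (R.*-congˡ (R.*-cong b≈ d≈)) ,
            R.+-cong (R.+-cong (R.*-cong a≈ d≈) (R.*-cong b≈ c≈)) (R.*-congˡ (R.*-cong b≈ d≈))
        ; *-assoc    = *-assoc
        ; *-identity = *-identityˡ , λ x → +.trans (*-comm x _) (*-identityˡ x)
        ; distrib    = distribˡ , λ x y z →
            +.trans (*-comm (y +.∙ z) x)
              (+.trans (distribˡ x y z) (+.∙-cong (*-comm x y) (*-comm x z)))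
        }
      ; *-comm = *-comm
      }
    }
    where
    open S using (solve; _:+_; _:*_; _:=_; con)

    *-comm : ∀ x y → x *′ y +.≈ y *′ x
    *-comm (a , b) (c , d) =
      solve 5 (λ a b c d q → a :* c :+ q :* (b :* d) := c :* a :+ q :* (d :* b)) R.refl a b c d q ,
      solve 5 (λ a b c d p → a :* d :+ b :* c :+ p :* (b :* d) :=
        c :* b :+ d :* a :+ p :* (d :* b)) R.refl a b c d p

    *-identityˡ : ∀ x → (1# , 0#) *′ x +.≈ x
    *-identityˡ (a , b) =
      solve 3 (λ a b q → con 1 :* a :+ q :* (con 0 :* b) := a) R.refl a b q ,
      solve 3 (λ a b p → con 1 :* b :+ con 0 :* a :+ p :* (con 0 :* b) := b) R.refl a b p

    distribˡ : ∀ x y z → x *′ (y +.∙ z) +.≈ (x *′ y) +.∙ (x *′ z)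
    distribˡ (a , b) (c , d) (e , f) =
      solve 7 (λ a b c d e f q → a :* (c :+ e) :+ q :* (b :* (d :+ f)) :=
        (a :* c :+ q :* (b :* d)) :+ (a :* e :+ q :* (b :* f))) R.refl a b c d e f q ,
      solve 7 (λ a b c d e f p → a :* (d :+ f) :+ b :* (c :+ e) :+ p :* (b :* (d :+ f)) :=
        (a :* d :+ b :* c :+ p :* (b :* d)) :+ (a :* f :+ b :* e :+ p :* (b :* f)))
        R.refl a b c d e f p

    *-assoc : ∀ x y z → (x *′ y) *′ z +.≈ x *′ (y *′ z)
    *-assoc (a , b) (c , d) (e , f) =
      solve 8 (λ a b c d e f p q →
        (a :* c :+ q :* (b :* d)) :* e :+ q :* ((a :* d :+ b :* c :+ p :* (b :* d)) :* f) :=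
        a :* (c :* e :+ q :* (d :* f)) :+ q :* (b :* (c :* f :+ d :* e :+ p :* (d :* f))))
        R.refl a b c d e f p q ,
      solve 8 (λ a b c d e f p q →
        (a :* c :+ q :* (b :* d)) :* f :+ (a :* d :+ b :* c :+ p :* (b :* d)) :* e :+
          p :* ((a :* d :+ b :* c :+ p :* (b :* d)) :* f) :=
        a :* (c :* f :+ d :* e :+ p :* (d :* f)) :+ b :* (c :* e :+ q :* (d :* f)) :+
          p :* (b :* (c :* f :+ d :* e :+ p :* (d :* f))))
        R.refl a b c d e f p q

  private
    module E = CommutativeRing extension
    module R∣ = Divisibility R.semiring
    module E∣ = Divisibility E.semiring
  open RingMorphisms R.rawRing E.rawRing

  constant : R.Carrier → E.Carrier
  constant a = a , 0#

  constant-* : ∀ a x → constant a E.* x E.≈ (a * proj₁ x , a * proj₂ x)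
  constant-* a (c , d) =
    solve 4 (λ a c d q → a :* c :+ q :* (con 0 :* d) := a :* c) R.refl a c d q ,
    solve 4 (λ a c d p → a :* d :+ con 0 :* c :+ p :* (con 0 :* d) := a :* d) R.refl a c d p
    where open S using (solve; _:+_; _:*_; _:=_; con)

  constant-isRingHomomorphism : IsRingHomomorphism constant
  constant-isRingHomomorphism = record
    { isSemiringHomomorphism = record
      { isNearSemiringHomomorphism = record
        { +-isMonoidHomomorphism = record
          { isMagmaHomomorphism = record
            { isRelHomomorphism = record { cong = λ a≈b → a≈b , R.refl }
            ; homo = λ a b → R.refl , R.sym (R.+-identityʳ 0#)
            }
          ; ε-homo = E.refl
          }
        ; *-homo = λ a b → E.sym (E.trans (constant-* a (constant b)) (R.refl , R.zeroʳ a))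
        }
      ; 1#-homo = E.refl
      }
    ; -‿homo = λ a → R.refl , R.sym -0#≈0#
    }
    where open import Algebra.Properties.Ring R.ring using (-0#≈0#)

  constant-cancel : ∀ {a} → (∀ {c d} → a * c ≈ a * d → c ≈ d) →
                    ∀ {x y} → constant a E.* x E.≈ constant a E.* y → x E.≈ y
  constant-cancel {a} a-cancel {x} {y} ax≈ay =
    let (e₀ , e₁) = E.trans (E.sym (constant-* a x)) (E.trans ax≈ay (constant-* a y)) in
    a-cancel e₀ , a-cancel e₁

  constant-∣ : ∀ {a x} → constant a E∣.∣ x → (a R∣.∣ proj₁ x) × (a R∣.∣ proj₂ x)
  constant-∣ {a} (u E∣., ua≈x) =
    let (e₀ , e₁) = E.trans (E.sym (constant-* a u)) (E.trans (E.*-comm (constant a) u) ua≈x) in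
    (proj₁ u R∣., R.trans (R.*-comm _ a) e₀) , (proj₂ u R∣., R.trans (R.*-comm _ a) e₁)

-- Divisibility by powers of π = 1 − ζ

module _ (R : CommutativeRing c ℓ) where
  open CommutativeRing R hiding (zero)
  open CommSemigroupDivisibility *-commutativeSemigroup
  open Divisibility semiring using (∣-refl)
  open Exp semiring
  open Product *-commutativeMonoid using () renaming (sum to ∏)
  private
    module ℕΣ = Product ℕ.+-0-commutativeMonoid

  ∏-∣ : {d f : Vector Carrier n} → (∀ k → d k ∣ f k) → ∏ d ∣ ∏ f
  ∏-∣ {zero}  d∣f = ∣-refl
  ∏-∣ {suc n} d∣f = ∙-cong-∣ (d∣f zero) (∏-∣ (d∣f ∘ suc))

  ^-cong-∣ : ∀ {x y} n → x ∣ y → x ^ n ∣ y ^ n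
  ^-cong-∣ zero    x∣y = ∣-refl
  ^-cong-∣ (suc n) x∣y = ∙-cong-∣ x∣y (^-cong-∣ n x∣y)

  ^-monoʳ-∣ : ∀ x {m n} → m ℕ.≤ n → x ^ m ∣ x ^ n
  ^-monoʳ-∣ x {m} {n} m≤n = x ^ (n ℕ.∸ m) , trans
    (sym (^-homo-* x (n ℕ.∸ m) m)) (^-congʳ x (ℕ.m∸n+n≡m m≤n))

  ∏-^ : ∀ x (e : Vector ℕ n) → ∏ (λ k → x ^ e k) ≈ x ^ ℕΣ.sum e
  ∏-^ {zero}  x e = refl
  ∏-^ {suc n} x e = trans (*-congˡ (∏-^ x (tail e))) (sym (^-homo-* x (e zero) _))

module _ (R : CommutativeRing c ℓ) where

  open CommutativeRing R hiding (zero)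
  open RingMorphisms ℤ.+-*-rawRing rawRing

  module Expansion {ι : ℤ → Carrier} (ι-isHom : IsRingHomomorphism ι)
                   (ζ π : Carrier) (ζ+π≈1 : ζ + π ≈ 1#) where

    open IsRingHomomorphism ι-isHom
    open Homomorphism ℤ.+-*-commutativeRing R ι-isHom using (sum-homo)
    open Divisibility semiring using (_∣_; _,_)
    open RingProperties ring
    open Exp semiring
    open Product *-commutativeMonoid using () renaming (sum to ∏)
    open Sum semiring
    open Sum ℤ.+-*-semiring using () renaming (sum to sumℤ)
    open Solver commutativeSemiring using (solve; _:+_; _:*_; _:=_; con)
    open ≈-Reasoning setoid

    ^-expansion : ∀ m → ∃ λ w → ζ ^ m + ι (+ m) * π ≈ 1# + w * (π * π)
    ^-expansion zero = 0# ,
      +-congˡ (trans (*-congʳ 0#-homo) (trans (zeroˡ π) (sym (zeroˡ (π * π)))))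
    ^-expansion (suc m) = let (w , eq) = ^-expansion m in ζ * w + ι (+ m) , (begin
      ζ * ζ ^ m + ι (+ suc m) * π
        ≈⟨ +-congˡ (*-congʳ (trans (+-homo 1ℤ (+ m)) (+-congʳ 1#-homo))) ⟩
      ζ * ζ ^ m + (1# + ι (+ m)) * π
        ≈⟨ +-congˡ (trans (distribʳ _ _ _)
             (+-congˡ (trans (sym (*-identityˡ _)) (*-congʳ (sym ζ+π≈1))))) ⟩
      ζ * ζ ^ m + (1# * π + (ζ + π) * (ι (+ m) * π))
        ≈⟨ solve 4 (λ z p k i → z :* k :+ (con 1 :* p :+ (z :+ p) :* (i :* p)) :=
             z :* (k :+ i :* p) :+ p :+ i :* (p :* p)) refl ζ π (ζ ^ m) (ι (+ m)) ⟩
      ζ * (ζ ^ m + ι (+ m) * π) + π + ι (+ m) * (π * π)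
        ≈⟨ +-congʳ (+-congʳ (*-congˡ eq)) ⟩
      ζ * (1# + w * (π * π)) + π + ι (+ m) * (π * π)
        ≈⟨ solve 4 (λ z p w i → z :* (con 1 :+ w :* (p :* p)) :+ p :+ i :* (p :* p) :=
             z :+ p :+ (z :* w :+ i) :* (p :* p)) refl ζ π w (ι (+ m)) ⟩
      ζ + π + (ζ * w + ι (+ m)) * (π * π)
        ≈⟨ +-congʳ ζ+π≈1 ⟩
      1# + (ζ * w + ι (+ m)) * (π * π)
        ∎)

    module _ (x : Vector ℤ n) (e : Vector ℕ n) where

      evaluation : Carrier
      evaluation = ∑[ i < n ] (ι (x i) * ζ ^ e i)

      augmentation derivative : ℤ
      augmentation = sumℤ x
      derivative   = sumℤ (λ i → x i ℤ.* + e i)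

      evaluation-expansion : ∃ λ w → evaluation + ι derivative * π ≈ ι augmentation + w * (π * π)
      evaluation-expansion = ∑[ i < n ] (ι (x i) * w i) , (begin
        evaluation + ι derivative * π
          ≈⟨ +-congˡ (trans (*-congʳ (sum-homo λ i → x i ℤ.* + e i))
               (*-distribʳ-sum π (λ i → ι (x i ℤ.* + e i)))) ⟩
        evaluation + ∑[ i < n ] (ι (x i ℤ.* + e i) * π)
          ≈⟨ ∑-distrib-+ (λ i → ι (x i) * ζ ^ e i) (λ i → ι (x i ℤ.* + e i) * π) ⟨
        ∑[ i < n ] (ι (x i) * ζ ^ e i + ι (x i ℤ.* + e i) * π)
          ≈⟨ sum-cong-≋ term ⟩
        ∑[ i < n ] (ι (x i) + ι (x i) * w i * (π * π))
          ≈⟨ ∑-distrib-+ (ι ∘ x) (λ i → ι (x i) * w i * (π * π)) ⟩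
        sum (ι ∘ x) + ∑[ i < n ] (ι (x i) * w i * (π * π))
          ≈⟨ +-cong (sym (sum-homo x)) (sym (*-distribʳ-sum (π * π) (λ i → ι (x i) * w i))) ⟩
        ι augmentation + ∑[ i < n ] (ι (x i) * w i) * (π * π)
          ∎)
        where
        w : Vector Carrier n
        w i = proj₁ (^-expansion (e i))

        term : ∀ i → ι (x i) * ζ ^ e i + ι (x i ℤ.* + e i) * π ≈ ι (x i) + ι (x i) * w i * (π * π)
        term i = begin
          ι (x i) * ζ ^ e i + ι (x i ℤ.* + e i) * π
            ≈⟨ +-congˡ (trans (*-congʳ (*-homo (x i) (+ e i))) (*-assoc _ _ _)) ⟩
          ι (x i) * ζ ^ e i + ι (x i) * (ι (+ e i) * π)
            ≈⟨ distribˡ _ _ _ ⟨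
          ι (x i) * (ζ ^ e i + ι (+ e i) * π)
            ≈⟨ *-congˡ (proj₂ (^-expansion (e i))) ⟩
          ι (x i) * (1# + w i * (π * π))
            ≈⟨ trans (distribˡ _ _ _) (+-cong (*-identityʳ _) (sym (*-assoc _ _ _))) ⟩
          ι (x i) + ι (x i) * w i * (π * π)
            ∎

      evaluation≈ : let w = proj₁ evaluation-expansion in
                    evaluation ≈ ι augmentation + (w * π + - ι derivative) * π
      evaluation≈ = let (w , eq) = evaluation-expansion in begin
        evaluation
          ≈⟨ trans (+-assoc _ _ _) (trans (+-congˡ (-‿inverseʳ _)) (+-identityʳ _)) ⟨
        evaluation + ι derivative * π + - (ι derivative * π)
          ≈⟨ +-cong eq (-‿distribˡ-* _ _) ⟩
        ι augmentation + w * (π * π) + - ι derivative * π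
          ≈⟨ solve 4 (λ a w p d → a :+ w :* (p :* p) :+ d :* p := a :+ (w :* p :+ d) :* p) refl
               (ι augmentation) w π (- ι derivative) ⟩
        ι augmentation + (w * π + - ι derivative) * π
          ∎

      π²∣evaluation : π * π ∣ ι augmentation → π ∣ ι derivative → π * π ∣ evaluation
      π²∣evaluation (u , uππ≈a) (v , vπ≈d) = let (w , _) = evaluation-expansion in
        u + (w + - v) , sym (begin
          evaluation
            ≈⟨ evaluation≈ ⟩
          ι augmentation + (w * π + - ι derivative) * π
            ≈⟨ +-cong (sym uππ≈a)
                 (*-congʳ (+-congˡ (trans (-‿cong (sym vπ≈d)) (-‿distribˡ-* v π)))) ⟩
          u * (π * π) + (w * π + - v * π) * π
            ≈⟨ solve 4 (λ u w v p → u :* (p :* p) :+ (w :* p :+ v :* p) :* p :=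
                 (u :+ (w :+ v)) :* (p :* p)) refl u w (- v) π ⟩
          (u + (w + - v)) * (π * π)
            ∎)

      π∣evaluation : π ∣ ι augmentation → π ∣ evaluation
      π∣evaluation (u , uπ≈a) = u + _ ,
        trans (distribʳ _ _ _) (trans (+-congʳ uπ≈a) (sym evaluation≈))

    ∏-mod-π : ∀ {t} {f u : Vector Carrier n} → (∀ k → f k ≈ t + u k * π) →
              ∃ λ v → ∏ f ≈ t ^ n + v * π
    ∏-mod-π {zero} f≈ = 0# , sym (trans (+-congˡ (zeroˡ π)) (+-identityʳ 1#))
    ∏-mod-π {suc n} {t} {f} {u} f≈ = let (v , eq) = ∏-mod-π (f≈ ∘ suc) in
      t * v + u zero * (t ^ n + v * π) , (begin
        f zero * ∏ (tail f)
          ≈⟨ *-cong (f≈ zero) eq ⟩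
        (t + u zero * π) * (t ^ n + v * π)
          ≈⟨ solve 5 (λ t u p k v → (t :+ u :* p) :* (k :+ v :* p) :=
               t :* k :+ (t :* v :+ u :* (k :+ v :* p)) :* p)
               refl t (u zero) π (t ^ n) v ⟩
        t ^ suc n + (t * v + u zero * (t ^ n + v * π)) * π
          ∎)

    ∑-shift : ∀ (x : Vector ℤ n) m (y : Vector Carrier n) →
              ∑[ i < n ] (ι (x i ℤ.+ m) * y i) ≈ ∑[ i < n ] (ι (x i) * y i) + ι m * sum y
    ∑-shift {n} x m y = begin
      ∑[ i < n ] (ι (x i ℤ.+ m) * y i)
        ≈⟨ sum-cong-≋ (λ i → trans (*-congʳ (+-homo (x i) m)) (distribʳ (y i) _ _)) ⟩
      ∑[ i < n ] (ι (x i) * y i + ι m * y i)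
        ≈⟨ ∑-distrib-+ (λ i → ι (x i) * y i) (λ i → ι m * y i) ⟩
      ∑[ i < n ] (ι (x i) * y i) + ∑[ i < n ] (ι m * y i)
        ≈⟨ +-congˡ (*-distribˡ-sum (ι m) y) ⟨
      ∑[ i < n ] (ι (x i) * y i) + ι m * sum y
        ∎

-- The group C₅ × C₅

module CyclicCharacters (R : CommutativeRing c ℓ) where
  open CommutativeRing R hiding (zero)
  open Exp semiring
  open Determinant R using (δ)
  open DedekindFactorization R using (Characters)
  open Sum semiring using (sum-syntax)
  open Mult semiring renaming (_×_ to _·_)
  open ≈-Reasoning setoid

  1^n≈1 : ∀ n → 1# ^ n ≈ 1#
  1^n≈1 zero    = refl
  1^n≈1 (suc n) = trans (*-identityˡ _) (1^n≈1 n)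

  ^-% : ∀ {x} n .{{_ : NonZero n}} → x ^ n ≈ 1# → ∀ m → x ^ (m % n) ≈ x ^ m
  ^-% {x} n xⁿ≈1 m = sym (begin
    x ^ m                            ≡⟨ ≡.cong (x ^_) (m≡m%n+[m/n]*n m n) ⟩
    x ^ (m % n ℕ.+ m / n ℕ.* n)      ≈⟨ ^-homo-* x (m % n) (m / n ℕ.* n) ⟩
    x ^ (m % n) * x ^ (m / n ℕ.* n)  ≡⟨ ≡.cong (λ k → x ^ (m % n) * x ^ k) (ℕ.*-comm (m / n) n) ⟩
    x ^ (m % n) * x ^ (n ℕ.* (m / n)) ≈⟨ *-congˡ (^-assocʳ x n (m / n)) ⟨
    x ^ (m % n) * (x ^ n) ^ (m / n)  ≈⟨ *-congˡ (trans (^-congˡ (m / n) xⁿ≈1) (1^n≈1 (m / n))) ⟩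
    x ^ (m % n) * 1#                 ≈⟨ *-identityʳ _ ⟩
    x ^ (m % n)                      ∎)

  cyclic : ∀ n .{{_ : NonZero n}} (ζ : Carrier) → ζ ^ n ≈ 1# →
    (∀ (k l : Fin n) →
      ∑[ i < n ] ((ζ ^ toℕ k) ^ toℕ i * (ζ ^ toℕ l) ^ toℕ (-ₘ_ n i)) ≈ (n · 1#) * δ k l) →
    Characters (C n)
  cyclic n ζ ζⁿ≈1 orth = record
    { χ          = λ k i → (ζ ^ toℕ k) ^ toℕ i
    ; χ-cong     = λ { k ≡.refl → refl }
    ; χ-homo     = λ k i j → begin
        (ζ ^ toℕ k) ^ toℕ (_+ₘ_ n i j)
          ≡⟨ ≡.cong ((ζ ^ toℕ k) ^_) (toℕ-fromℕ< (m%n<n (toℕ i ℕ.+ toℕ j) n)) ⟩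
        (ζ ^ toℕ k) ^ ((toℕ i ℕ.+ toℕ j) % n)
          ≈⟨ ^-% n (root k) (toℕ i ℕ.+ toℕ j) ⟩
        (ζ ^ toℕ k) ^ (toℕ i ℕ.+ toℕ j)
          ≈⟨ ^-homo-* (ζ ^ toℕ k) (toℕ i) (toℕ j) ⟩
        (ζ ^ toℕ k) ^ toℕ i * (ζ ^ toℕ k) ^ toℕ j
          ∎
    ; orthogonal = orth
    }
    where
    root : ∀ k → (ζ ^ toℕ {n} k) ^ n ≈ 1#
    root k = begin
      (ζ ^ toℕ k) ^ n   ≈⟨ ^-assocʳ ζ (toℕ k) n ⟩
      ζ ^ (toℕ k ℕ.* n) ≡⟨ ≡.cong (ζ ^_) (ℕ.*-comm (toℕ k) n) ⟩
      ζ ^ (n ℕ.* toℕ k) ≈⟨ ^-assocʳ ζ n (toℕ k) ⟨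
      (ζ ^ n) ^ toℕ k   ≈⟨ ^-congˡ (toℕ k) ζⁿ≈1 ⟩
      1# ^ toℕ k        ≈⟨ 1^n≈1 (toℕ k) ⟩
      1#                ∎

open import Data.Vec.Base using (Vec; []; _∷_; lookup)

-- Five elements of the group ring, found by computer search: the r-th one has
-- augmentation 5 r, and its values at the 24 nontrivial characters multiply to
-- 5⁷. Rows are indexed by the first coordinate of the group.
coefficients : Fin 5 → Vec (Vec ℤ 5) 5
coefficients 0F =
  (+ 0 ∷ + 0 ∷ + 0 ∷ -1ℤ ∷ + 0 ∷ []) ∷
  (+ 0 ∷ + 0 ∷ + 0 ∷ + 0 ∷ + 0 ∷ []) ∷
  (+ 0 ∷ + 0 ∷ + 1 ∷ + 1 ∷ + 0 ∷ []) ∷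
  (+ 0 ∷ + 0 ∷ + 0 ∷ + 0 ∷ + 0 ∷ []) ∷
  (+ 0 ∷ + 0 ∷ + 0 ∷ -1ℤ ∷ + 0 ∷ []) ∷ []
coefficients 1F =
  (+ 0 ∷ + 0 ∷ + 0 ∷ + 0 ∷ + 0 ∷ []) ∷
  (+ 1 ∷ + 0 ∷ + 1 ∷ + 0 ∷ + 0 ∷ []) ∷
  (+ 1 ∷ + 0 ∷ + 0 ∷ + 1 ∷ + 0 ∷ []) ∷
  (+ 0 ∷ + 0 ∷ + 1 ∷ + 0 ∷ + 0 ∷ []) ∷
  (+ 0 ∷ + 0 ∷ + 0 ∷ + 0 ∷ + 0 ∷ []) ∷ []
coefficients 2F =
  (+ 2 ∷ + 0 ∷ + 1 ∷ + 1 ∷ + 0 ∷ []) ∷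
  (+ 0 ∷ + 0 ∷ + 0 ∷ + 0 ∷ + 0 ∷ []) ∷
  (+ 1 ∷ + 1 ∷ + 0 ∷ + 1 ∷ + 0 ∷ []) ∷
  (+ 1 ∷ + 0 ∷ + 1 ∷ + 0 ∷ + 0 ∷ []) ∷
  (+ 0 ∷ + 0 ∷ + 0 ∷ + 1 ∷ + 0 ∷ []) ∷ []
coefficients 3F =
  (-1ℤ ∷ + 1 ∷ + 0 ∷ + 0 ∷ + 1 ∷ []) ∷
  (+ 1 ∷ + 1 ∷ + 1 ∷ + 1 ∷ + 1 ∷ []) ∷
  (+ 0 ∷ + 0 ∷ + 1 ∷ + 0 ∷ + 1 ∷ []) ∷
  (+ 0 ∷ + 1 ∷ + 0 ∷ + 1 ∷ + 1 ∷ []) ∷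
  (+ 1 ∷ + 1 ∷ + 1 ∷ + 0 ∷ + 1 ∷ []) ∷ []
coefficients 4F =
  (+ 1 ∷ + 1 ∷ + 1 ∷ + 1 ∷ + 1 ∷ []) ∷
  (+ 0 ∷ + 1 ∷ + 0 ∷ + 1 ∷ + 1 ∷ []) ∷
  (+ 0 ∷ + 1 ∷ + 1 ∷ + 0 ∷ + 1 ∷ []) ∷
  (+ 1 ∷ + 1 ∷ + 0 ∷ + 1 ∷ + 1 ∷ []) ∷
  (+ 1 ∷ + 1 ∷ + 1 ∷ + 1 ∷ + 1 ∷ []) ∷ []

base : Fin 5 → Fin 5 × Fin 5 → ℤ
base r (i , j) = lookup (lookup (coefficients r) i) j

private
  C₅² = C 5 ×ᴳ C 5

open FiniteGroup C₅² using (element)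

open Sum ℤ.+-*-semiring using ()
  renaming (sum to sumℤ; sum-cong-≗ to sumℤ-cong; ∑-distrib-+ to sumℤ-distrib-+;
            *-distribˡ-sum to *-distribˡ-sumℤ; *-distribʳ-sum to *-distribʳ-sumℤ)
open Exp ℤ.+-*-semiring using () renaming (_^_ to _^ℤ_)
module ℕΣ = Product ℕ.+-0-commutativeMonoid

5∣^⇒5∣ : ∀ z n → + 5 ℤ∣.∣ z ^ℤ n → + 5 ℤ∣.∣ z
5∣^⇒5∣ z zero    5∣1 = contradiction (ℤ∣.∣⇒∣ᵤ 5∣1) (from-no (5 ℕ.∣? 1))
5∣^⇒5∣ z (suc n) 5∣zzⁿ = [ ℤ∣.∣ᵤ⇒∣ , 5∣^⇒5∣ z n ∘ ℤ∣.∣ᵤ⇒∣ ]′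
  (euclidsLemma ∣ z ∣ ∣ z ^ℤ n ∣ (from-yes (prime? 5))
    (≡.subst (5 ℕ.∣_) (ℤ.abs-* z (z ^ℤ n)) (ℤ∣.∣⇒∣ᵤ 5∣zzⁿ)))

sumℤ-linear : ∀ (x : Vector ℤ n) a b (u v : Vector ℕ n) →
  sumℤ (λ i → x i ℤ.* + (a ℕ.* u i ℕ.+ b ℕ.* v i)) ≡
  + a ℤ.* sumℤ (λ i → x i ℤ.* + u i) ℤ.+ + b ℤ.* sumℤ (λ i → x i ℤ.* + v i)
sumℤ-linear x a b u v = ≡.trans (sumℤ-cong term) (≡.trans
  (sumℤ-distrib-+ (λ i → + a ℤ.* (x i ℤ.* + u i)) (λ i → + b ℤ.* (x i ℤ.* + v i)))
  (≡.cong₂ ℤ._+_ (≡.sym (*-distribˡ-sumℤ (+ a) (λ i → x i ℤ.* + u i)))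
                 (≡.sym (*-distribˡ-sumℤ (+ b) (λ i → x i ℤ.* + v i)))))
  where
  term : ∀ i → x i ℤ.* + (a ℕ.* u i ℕ.+ b ℕ.* v i) ≡
               + a ℤ.* (x i ℤ.* + u i) ℤ.+ + b ℤ.* (x i ℤ.* + v i)
  term i = ≡.trans
    (≡.cong (x i ℤ.*_) (≡.cong₂ ℤ._+_ (ℤ.pos-* a (u i)) (ℤ.pos-* b (v i))))
    (solve 5 (λ x a b u v → x :* (a :* u :+ b :* v) := a :* (x :* u) :+ b :* (x :* v))
      ≡.refl (x i) (+ a) (+ b) (+ u i) (+ v i))
    where open +-*-Solver

∣-%ℕ : ∀ d .{{_ : NonZero d}} a b y z → d ℕ.∣ a ℕ.* (y %ℕ d) ℕ.+ b ℕ.* (z %ℕ d) →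
       + d ℤ∣.∣ + a ℤ.* y ℤ.+ + b ℤ.* z
∣-%ℕ d a b y z d∣ = ≡.subst (+ d ℤ∣.∣_) (≡.sym split)
  (ℤ∣.∣m∣n⇒∣m+n {m = + r} (ℤ∣.∣ᵤ⇒∣ d∣) (ℤ∣.∣n⇒∣m*n q ℤ∣.∣-refl))
  where
  open +-*-Solver

  r = a ℕ.* (y %ℕ d) ℕ.+ b ℕ.* (z %ℕ d)
  q = + a ℤ.* (y /ℕ d) ℤ.+ + b ℤ.* (z /ℕ d)

  split : + a ℤ.* y ℤ.+ + b ℤ.* z ≡ + r ℤ.+ q ℤ.* + d
  split = ≡.trans
    (≡.cong₂ (λ y z → + a ℤ.* y ℤ.+ + b ℤ.* z) (a≡a%ℕn+[a/ℕn]*n y d) (a≡a%ℕn+[a/ℕn]*n z d))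
    (≡.trans
      (solve 7 (λ a b r s q t d → a :* (r :+ q :* d) :+ b :* (s :+ t :* d) :=
        (a :* r :+ b :* s) :+ (a :* q :+ b :* t) :* d)
        ≡.refl (+ a) (+ b) (+ (y %ℕ d)) (+ (z %ℕ d)) (y /ℕ d) (z /ℕ d) (+ d))
      (≡.cong (ℤ._+ q ℤ.* + d) (≡.sym (≡.cong₂ ℤ._+_ (ℤ.pos-* a (y %ℕ d)) (ℤ.pos-* b (z %ℕ d))))))

exponent : Fin 25 → Fin 5 × Fin 5 → ℕ
exponent k (i , j) = let (a , b) = remQuot {5} 5 k in toℕ a ℕ.* toℕ i ℕ.+ toℕ b ℕ.* toℕ j

-- If 5 divides the augmentation of a group ring element with first moments s
-- and t modulo 5, then π to this power divides its value at the character k.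
multiplicity : ℕ → ℕ → Fin 25 → ℕ
multiplicity s t zero      = 4
multiplicity s t k@(suc _) = let (a , b) = remQuot {5} 5 k in
  if does (5 ℕ.∣? (toℕ a ℕ.* s ℕ.+ toℕ b ℕ.* t)) then 2 else 1

-- 4 at the trivial character, 1 at each of the 24 others, and 1 more at the 4
-- nonzero multiples of a solution (a , b) of a s + b t ≡ 0.
total-multiplicity : ∀ s t → s ℕ.< 5 → t ℕ.< 5 → 32 ℕ.≤ ℕΣ.sum (multiplicity s t)
total-multiplicity s t s<5 t<5 = ≡.subst₂ (λ s t → 32 ℕ.≤ ℕΣ.sum (multiplicity s t))
  (toℕ-fromℕ< s<5) (toℕ-fromℕ< t<5) (table (fromℕ< s<5) (fromℕ< t<5))
  where
  table : ∀ (s t : Fin 5) → 32 ℕ.≤ ℕΣ.sum (multiplicity (toℕ s) (toℕ t))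
  table = from-yes (all? λ (s : Fin 5) → all? λ (t : Fin 5) →
    32 ℕ.≤? ℕΣ.sum (multiplicity (toℕ s) (toℕ t)))

sum-base : ∀ r → sumℤ (base r ∘ element) ≡ + toℕ r ℤ.* + 5
sum-base 0F = ≡.refl
sum-base 1F = ≡.refl
sum-base 2F = ≡.refl
sum-base 3F = ≡.refl
sum-base 4F = ≡.refl

sumℤ-const : ∀ m → sumℤ {25} (λ _ → m) ≡ + 25 ℤ.* m
sumℤ-const m = ≡.trans
  (sumℤ-cong {25} {λ _ → m} {λ _ → 1ℤ ℤ.* m} (λ _ → ≡.sym (ℤ.*-identityˡ m)))
  (≡.sym (*-distribʳ-sumℤ {25} m (λ _ → 1ℤ)))

remainder₅ : ℤ → Fin 5
remainder₅ q = fromℕ< (n%ℕd<d q 5)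

representative : ℤ → Fin 5 × Fin 5 → ℤ
representative q g = base (remainder₅ q) g ℤ.+ q /ℕ 5

sum-representative : ∀ q → sumℤ (representative q ∘ element) ≡ q ℤ.* + 5
sum-representative q = begin
  sumℤ (representative q ∘ element)
    ≡⟨ sumℤ-distrib-+ (base r ∘ element) (λ _ → t) ⟩
  sumℤ (base r ∘ element) ℤ.+ sumℤ {25} (λ _ → t)
    ≡⟨ ≡.cong₂ ℤ._+_ (sum-base r) (sumℤ-const t) ⟩
  + toℕ r ℤ.* + 5 ℤ.+ + 25 ℤ.* t
    ≡⟨ solve 2 (λ r t → r :* con (+ 5) :+ con (+ 25) :* t := (r :+ t :* con (+ 5)) :* con (+ 5))
         ≡.refl (+ toℕ r) t ⟩
  (+ toℕ r ℤ.+ t ℤ.* + 5) ℤ.* + 5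
    ≡⟨ ≡.cong (λ k → (+ k ℤ.+ t ℤ.* + 5) ℤ.* + 5) (toℕ-fromℕ< (n%ℕd<d q 5)) ⟩
  (+ (q %ℕ 5) ℤ.+ t ℤ.* + 5) ℤ.* + 5
    ≡⟨ ≡.cong (ℤ._* + 5) (a≡a%ℕn+[a/ℕn]*n q 5) ⟨
  q ℤ.* + 5
    ∎
  where
  open ≡.≡-Reasoning
  open +-*-Solver

  r = remainder₅ q
  t = q /ℕ 5

module _ {c ℓ} (R : CommutativeRing c ℓ) where

  open CommutativeRing R hiding (zero)
  open Exp semiring
  open Sum semiring
  open Mult semiring using () renaming (_×_ to _·_)
  open Determinant R using (δ)
  open RingMorphisms ℤ.+-*-rawRing rawRing

  module Values
    (ι : ℤ → Carrier) (ι-isRingHomomorphism : IsRingHomomorphism ι)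
    (ι-cancel : ∀ a .{{_ : ℤ.NonZero a}} {u v} → ι a * u ≈ ι a * v → u ≈ v)
    (ζ : Carrier) (ζ⁵≈1 : ζ ^ 5 ≈ 1#)
    (orthogonality : ∀ (k l : Fin 5) →
      ∑[ i < 5 ] ((ζ ^ toℕ k) ^ toℕ i * (ζ ^ toℕ l) ^ toℕ (-ₘ_ 5 i)) ≈ (5 · 1#) * δ k l)
    (π : Carrier) (ζ+π≈1 : ζ + π ≈ 1#)
    where

    open RingProperties ring
    open Expansion R ι-isRingHomomorphism ζ π ζ+π≈1
    open DedekindFactorization R
    open Product *-commutativeMonoid using () renaming (sum to ∏; sum-cong-≋ to ∏-cong)
    open Divisibility semiring
    open CyclicCharacters R using (cyclic; 1^n≈1)
    open module ι = IsRingHomomorphism ι-isRingHomomorphism using ()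
    open Homomorphism ℤ.+-*-commutativeRing R ι-isRingHomomorphism
    open ≈-Reasoning setoid

    characters : Characters C₅²
    characters = C₅ ×ᶜ C₅
      where
      C₅ : Characters (C 5)
      C₅ = cyclic 5 ζ ζ⁵≈1 orthogonality

    open Characters characters

    value : (Fin 5 × Fin 5 → ℤ) → Vector Carrier 25
    value x k = ∑[ i < 25 ] (ι (x (element i)) * χ k (element i))

    n·1≈ι : ∀ n → n · 1# ≈ ι (+ n)
    n·1≈ι zero    = sym ι.0#-homo
    n·1≈ι (suc n) = trans (+-cong (sym ι.1#-homo) (n·1≈ι n)) (sym (ι.+-homo 1ℤ (+ n)))

    Θ-∏ : ∀ (x : Func (FiniteGroup.setoid C₅²) (≡.setoid ℤ)) →
          ι (Θ ℤ.+-*-commutativeRing C₅² x) ≈ ∏ (value (Func.to x))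
    Θ-∏ = Θ-factors ℤ.+-*-commutativeRing ι-isRingHomomorphism C₅² characters
      (λ eq → ι-cancel (+ 25) (trans (*-congʳ (sym (n·1≈ι 25))) (trans eq (*-congʳ (n·1≈ι 25)))))

    χ-^ : ∀ k g → χ k g ≈ ζ ^ exponent k g
    χ-^ k (i , j) = let (a , b) = remQuot {5} 5 k in trans
      (*-cong (^-assocʳ ζ (toℕ a) (toℕ i)) (^-assocʳ ζ (toℕ b) (toℕ j)))
      (sym (^-homo-* ζ (toℕ a ℕ.* toℕ i) (toℕ b ℕ.* toℕ j)))

    χ-zero : ∀ g → χ zero g ≈ 1#
    χ-zero (i , j) = trans (*-cong (1^n≈1 (toℕ i)) (1^n≈1 (toℕ j))) (*-identityˡ 1#)

    module _ (x : Fin 5 × Fin 5 → ℤ) where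

      value-evaluation : ∀ k → value x k ≈ evaluation (x ∘ element) (exponent k ∘ element)
      value-evaluation k = sum-cong-≋ {25} λ i → *-congˡ {ι (x (element i))} (χ-^ k (element i))

      value-zero : value x zero ≈ ι (sumℤ (x ∘ element))
      value-zero = trans
        (sum-cong-≋ {25} {λ i → ι (x (element i)) * χ zero (element i)} {ι ∘ x ∘ element} λ i →
          trans (*-congˡ {ι (x (element i))} (χ-zero (element i)))
                (*-identityʳ (ι (x (element i)))))
        (sym (sum-homo (x ∘ element)))

    module _ (π-reflects-∣ : ∀ z → π ∣ ι z → + 5 ℤ∣.∣ z)
             (ι-reflects-∣ : ∀ a z → ι a ∣ ι z → a ℤ∣.∣ z)
             (ι5∣π⁴ : ι (+ 5) ∣ π ^ 4) (π⁴∣ι5 : π ^ 4 ∣ ι (+ 5))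
      where

      ι-∣ : ∀ {a z} → a ℤ∣.∣ z → ι a ∣ ι z
      ι-∣ {a} (divides q z≡qa) = ι q ,
        trans (sym (ι.*-homo q a)) (reflexive (≡.cong ι (≡.sym z≡qa)))

      π⁴∣ : ∀ {z} → + 5 ℤ∣.∣ z → π ^ 4 ∣ ι z
      π⁴∣ 5∣z = ∣-trans π⁴∣ι5 (ι-∣ 5∣z)

      π²∣ : ∀ {z} → + 5 ℤ∣.∣ z → π * π ∣ ι z
      π²∣ 5∣z = ∣-trans
        (π * π , trans (*-assoc π π (π * π)) (*-congˡ (*-congˡ (*-congˡ (sym (*-identityʳ π))))))
        (π⁴∣ 5∣z)

      π∣ : ∀ {z} → + 5 ℤ∣.∣ z → π ∣ ι z
      π∣ 5∣z = ∣-trans (π , refl) (π²∣ 5∣z)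

      π^∣evaluation : ∀ (x : Vector ℤ n) e {w} → + 5 ℤ∣.∣ sumℤ x →
        (5∣?w : Dec (5 ℕ.∣ w)) → (5 ℕ.∣ w → + 5 ℤ∣.∣ derivative x e) →
        π ^ (if does 5∣?w then 2 else 1) ∣ evaluation x e
      π^∣evaluation x e 5∣x (no  _)   5∣de =
        ∣-respˡ-≈ (sym (*-identityʳ π)) (π∣evaluation x e (π∣ 5∣x))
      π^∣evaluation x e 5∣x (yes 5∣w) 5∣de =
        ∣-respˡ-≈ (*-congˡ (sym (*-identityʳ π))) (π²∣evaluation x e (π²∣ 5∣x) (π∣ (5∣de 5∣w)))

      π∣^ : ∀ t {f u : Vector Carrier n} → (∀ k → f k ≈ ι t + u k * π) → π ∣ ∏ f → π ∣ ι (t ^ℤ n)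
      π∣^ {n} t {f} f≈ (w , wπ≈) = let (v , ∏≈) = ∏-mod-π f≈ in w + - v , (begin
        (w + - v) * π                   ≈⟨ distribʳ _ _ _ ⟩
        w * π + - v * π                 ≈⟨ +-cong (trans wπ≈ ∏≈) (sym (-‿distribˡ-* v π)) ⟩
        ι t ^ n + v * π + - (v * π)     ≈⟨ +-assoc _ _ _ ⟩
        ι t ^ n + (v * π + - (v * π))   ≈⟨ +-congˡ (-‿inverseʳ _) ⟩
        ι t ^ n + 0#                    ≈⟨ +-identityʳ _ ⟩
        ι t ^ n                         ≈⟨ ^-homo t n ⟨
        ι (t ^ℤ n)                      ∎)

      module _ (x : Fin 5 × Fin 5 → ℤ) where

        private
          s s₁ s₂ : ℤ
          s  = sumℤ (x ∘ element)
          s₁ = sumℤ (λ i → x (element i) ℤ.* + toℕ (proj₁ (element i)))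
          s₂ = sumℤ (λ i → x (element i) ℤ.* + toℕ (proj₂ (element i)))

        5∣augmentation : π ∣ ∏ (value x) → + 5 ℤ∣.∣ s
        5∣augmentation π∣∏ = 5∣^⇒5∣ s 25 (π-reflects-∣ (s ^ℤ 25)
          (π∣^ s (λ k → trans (value-evaluation x k)
            (evaluation≈ (x ∘ element) (exponent k ∘ element))) π∣∏))

        module _ (5∣s : + 5 ℤ∣.∣ s) where

          5∣derivative : ∀ k → let (a , b) = remQuot {5} 5 k in
                         5 ℕ.∣ toℕ a ℕ.* (s₁ %ℕ 5) ℕ.+ toℕ b ℕ.* (s₂ %ℕ 5) →
                         + 5 ℤ∣.∣ derivative (x ∘ element) (exponent k ∘ element)
          5∣derivative k 5∣ = let (a , b) = remQuot {5} 5 k in ≡.subst (+ 5 ℤ∣.∣_)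
            (≡.sym (sumℤ-linear (x ∘ element) (toℕ a) (toℕ b)
              (toℕ ∘ proj₁ ∘ element) (toℕ ∘ proj₂ ∘ element)))
            (∣-%ℕ 5 (toℕ a) (toℕ b) s₁ s₂ 5∣)

          π^multiplicity∣value : ∀ k → π ^ multiplicity (s₁ %ℕ 5) (s₂ %ℕ 5) k ∣ value x k
          π^multiplicity∣value zero    = ∣-respʳ-≈ (sym (value-zero x)) (π⁴∣ 5∣s)
          π^multiplicity∣value (suc k) = ∣-respʳ-≈ (sym (value-evaluation x (suc k)))
            (π^∣evaluation (x ∘ element) (exponent (suc k) ∘ element) 5∣s
              (5 ℕ.∣? _) (5∣derivative (suc k)))

          5⁸∣∏value : ι (+ 5) ^ 8 ∣ ∏ (value x)
          5⁸∣∏value = ∣-trans (^-cong-∣ R 8 ι5∣π⁴)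
            (∣-trans (∣-respˡ-≈ (sym (^-assocʳ π 4 8))
              (^-monoʳ-∣ R π (total-multiplicity _ _ (n%ℕd<d s₁ 5) (n%ℕd<d s₂ 5))))
            (∣-respˡ-≈ (∏-^ R π (multiplicity (s₁ %ℕ 5) (s₂ %ℕ 5))) (∏-∣ R π^multiplicity∣value)))

      5⁸∣Θ : ∀ {z} → (S C₅² ∩ 5 ·ℤ) z → ((5 ℕ.^ 8) ·ℤ) z
      5⁸∣Θ {z} ((x , Θ≡z) , 5∣z) = ι-reflects-∣ ((+ 5) ^ℤ 8) z
        (∣-respˡ-≈ (sym (^-homo (+ 5) 8)) (∣-respʳ-≈ ∏≈ιz (5⁸∣∏value (Func.to x)
          (5∣augmentation (Func.to x) (∣-respʳ-≈ (sym ∏≈ιz) (π∣ 5∣z))))))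
        where
        ∏≈ιz : ∏ (value (Func.to x)) ≈ ι z
        ∏≈ιz = trans (sym (Θ-∏ x)) (reflexive (≡.cong ι Θ≡z))

    ∑χ≈0 : ∀ k → ∑[ i < 25 ] χ (suc k) (element i) ≈ 0#
    ∑χ≈0 k = begin
      ∑[ i < 25 ] χ (suc k) (element i)
        ≈⟨ sum-cong-≋ {25} (λ i → trans
             (*-congˡ {χ (suc k) (element i)} (χ-zero (element i ⁻¹)))
             (*-identityʳ (χ (suc k) (element i)))) ⟨
      ∑[ i < 25 ] (χ (suc k) (element i) * χ zero (element i ⁻¹))
        ≈⟨ orthogonal (suc k) zero ⟩
      (25 · 1#) * 0#
        ≈⟨ zeroʳ (25 · 1#) ⟩
      0#
        ∎
      where open FiniteGroup C₅² using (_⁻¹)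

    value-shift : ∀ x m k → value (λ g → x g ℤ.+ m) (suc k) ≈ value x (suc k)
    value-shift x m k = trans
      (∑-shift (x ∘ element) m (χ (suc k) ∘ element))
      (trans (+-congˡ (trans (*-congˡ (∑χ≈0 k)) (zeroʳ (ι m)))) (+-identityʳ _))

    module _ (ι-injective : ∀ {y z} → ι y ≈ ι z → y ≡ z)
             (∏-base : ∀ r → ∏ (tail (value (base r))) ≈ ι (+ (5 ℕ.^ 7)))
      where

      multiple-attained : ∀ q → S C₅² (q ℤ.* + (5 ℕ.^ 8))
      multiple-attained q = x , ι-injective (begin
        ι (Θ ℤ.+-*-commutativeRing C₅² x)
          ≈⟨ Θ-∏ x ⟩
        value (representative q) zero * ∏ (tail (value (representative q)))
          ≈⟨ *-cong (value-zero (representative q))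
               (trans (∏-cong {24} (value-shift (base (remainder₅ q)) (q /ℕ 5)))
                      (∏-base (remainder₅ q))) ⟩
        ι (sumℤ (representative q ∘ element)) * ι (+ (5 ℕ.^ 7))
          ≈⟨ ι.*-homo (sumℤ (representative q ∘ element)) (+ (5 ℕ.^ 7)) ⟨
        ι (sumℤ (representative q ∘ element) ℤ.* + (5 ℕ.^ 7))
          ≡⟨ ≡.cong (λ s → ι (s ℤ.* + (5 ℕ.^ 7))) (sum-representative q) ⟩
        ι (q ℤ.* + 5 ℤ.* + (5 ℕ.^ 7))
          ≡⟨ ≡.cong ι (ℤ.*-assoc q (+ 5) (+ (5 ℕ.^ 7))) ⟩
        ι (q ℤ.* + (5 ℕ.^ 8))
          ∎)
        where
        x : Func (FiniteGroup.setoid C₅²) (≡.setoid ℤ)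
        x = record { to = representative q ; cong = λ { (≡.refl , ≡.refl) → ≡.refl } }

-- The ring ℤ[ζ]

-- φ = ζ + ζ⁻¹ satisfies φ² = 1 − φ, and ζ satisfies ζ² = φ ζ − 1.
module ℤ[φ] = Quadratic ℤ.+-*-commutativeRing -1ℤ 1ℤ
module ℤ[ζ] = Quadratic ℤ[φ].extension (0ℤ , 1ℤ) (-1ℤ , 0ℤ)

open CommutativeRing ℤ[ζ].extension hiding (zero)
open Divisibility semiring
private module ∣ℤ = Divisibility (CommutativeRing.semiring ℤ.+-*-commutativeRing)
open RingMorphisms ℤ.+-*-rawRing rawRing
open Exp semiring using () renaming (_^_ to _^ᶻ_)
open Sum semiring using (sum-syntax)
open Mult semiring using () renaming (_×_ to _·_)
open Determinant ℤ[ζ].extension using (δ)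

infix 4 _≈?_

_≈?_ : Decidable _≈_
_≈?_ = ×-decidable (×-decidable ℤ._≟_ ℤ._≟_) (×-decidable ℤ._≟_ ℤ._≟_)

ζ π : Carrier
ζ = (0ℤ , 0ℤ) , (1ℤ , 0ℤ)
π = (1ℤ , 0ℤ) , (-1ℤ , 0ℤ)

ι : ℤ → Carrier
ι = ℤ[ζ].constant ∘ ℤ[φ].constant

ι-isRingHomomorphism : IsRingHomomorphism ι
ι-isRingHomomorphism = Composition.isRingHomomorphism trans
  ℤ[φ].constant-isRingHomomorphism ℤ[ζ].constant-isRingHomomorphism

ι-∣ : ∀ a {x} → ι a ∣ x → (a ℤ∣.∣ proj₁ (proj₁ x)) × (a ℤ∣.∣ proj₂ (proj₂ x))
ι-∣ a a∣x =
  let (a∣x₀ , a∣x₁) = ℤ[ζ].constant-∣ a∣x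
      ((q ∣ℤ., qa≡) , _) = ℤ[φ].constant-∣ a∣x₀
      (_ , (r ∣ℤ., ra≡)) = ℤ[φ].constant-∣ a∣x₁
  in divides q (≡.sym qa≡) , divides r (≡.sym ra≡)

π-reflects-∣ : ∀ z → π ∣ ι z → + 5 ℤ∣.∣ z
π-reflects-∣ z (u , uπ≈z) = ≡.subst (+ 5 ℤ∣.∣_) last-coefficient
  (proj₂ (ι-∣ (+ 5) {ι z * σ} (u , (begin
    u * ι (+ 5)  ≈⟨ *-congˡ {u} (from-yes (ι (+ 5) ≈? π * σ)) ⟩
    u * (π * σ)  ≈⟨ *-assoc u π σ ⟨
    u * π * σ    ≈⟨ *-congʳ {σ} uπ≈z ⟩
    ι z * σ      ∎))))
  where
  open import Relation.Binary.Reasoning.Setoid setoid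

  -- 5 / (1 − ζ)
  σ : Carrier
  σ = (+ 2 , -1ℤ) , (+ 3 , 1ℤ)

  last-coefficient : proj₂ (proj₂ (ι z * σ)) ≡ z
  last-coefficient = ≡.trans (proj₂ (proj₂ (ℤ[ζ].constant-* (ℤ[φ].constant z) σ)))
    (≡.trans (proj₂ (ℤ[φ].constant-* z (+ 3 , 1ℤ))) (ℤ.*-identityʳ z))

ι-cancel : ∀ a .{{_ : ℤ.NonZero a}} {u v} → ι a * u ≈ ι a * v → u ≈ v
ι-cancel a {u} {v} = ℤ[ζ].constant-cancel {ℤ[φ].constant a} φ-cancel {u} {v}
  where
  module 𝔽 = CommutativeRing ℤ[φ].extension

  φ-cancel : ∀ {u v} → ℤ[φ].constant a 𝔽.* u 𝔽.≈ ℤ[φ].constant a 𝔽.* v → u 𝔽.≈ v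
  φ-cancel {u} {v} = ℤ[φ].constant-cancel {a} (ℤ.*-cancelˡ-≡ a _ _) {u} {v}

ζ⁵≈1 : ζ ^ᶻ 5 ≈ 1#
ζ⁵≈1 = from-yes (ζ ^ᶻ 5 ≈? 1#)

ζ+π≈1 : ζ + π ≈ 1#
ζ+π≈1 = from-yes (ζ + π ≈? 1#)

orthogonality : ∀ (k l : Fin 5) →
  ∑[ i < 5 ] ((ζ ^ᶻ toℕ k) ^ᶻ toℕ i * (ζ ^ᶻ toℕ l) ^ᶻ toℕ (-ₘ_ 5 i)) ≈ (5 · 1#) * δ k l
orthogonality = from-yes (all? λ k → all? λ l →
  ∑[ i < 5 ] ((ζ ^ᶻ toℕ k) ^ᶻ toℕ i * (ζ ^ᶻ toℕ l) ^ᶻ toℕ (-ₘ_ 5 i)) ≈? (5 · 1#) * δ {5} k l)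

open Values ℤ[ζ].extension ι ι-isRingHomomorphism ι-cancel ζ ζ⁵≈1 orthogonality π ζ+π≈1
  using (value; multiple-attained) renaming (5⁸∣Θ to 5⁸∣Θ-criterion)

∏-base : ∀ r → Product.sum *-commutativeMonoid (tail (value (base r))) ≈ ι (+ (5 ℕ.^ 7))
∏-base 0F = (≡.refl , ≡.refl) , (≡.refl , ≡.refl)
∏-base 1F = (≡.refl , ≡.refl) , (≡.refl , ≡.refl)
∏-base 2F = (≡.refl , ≡.refl) , (≡.refl , ≡.refl)
∏-base 3F = (≡.refl , ≡.refl) , (≡.refl , ≡.refl)
∏-base 4F = (≡.refl , ≡.refl) , (≡.refl , ≡.refl)

5⁸∣Θ : ∀ {z} → (S C₅² ∩ 5 ·ℤ) z → ((5 ℕ.^ 8) ·ℤ) z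
5⁸∣Θ = 5⁸∣Θ-criterion π-reflects-∣ (λ a z → proj₁ ∘ ι-∣ a {ι z})
  (unit , from-yes (unit * ι (+ 5) ≈? π ^ᶻ 4))
  (unit⁻¹ , from-yes (unit⁻¹ * π ^ᶻ 4 ≈? ι (+ 5)))
  where
  unit unit⁻¹ : Carrier
  unit   = (-1ℤ , 1ℤ) , (-1ℤ , + 2)
  unit⁻¹ = (-1ℤ , -1ℤ) , (-1ℤ , -1ℤ)

open import Data.Nat.Base using (_^_)

theorem1p1 : (S (C 5 ×ᴳ C 5) ∩ 5 ·ℤ) ≐ (5 ^ 8) ·ℤ
theorem1p1 = 5⁸∣Θ , λ { 5⁸∣z@(divides q ≡.refl) →
  multiple-attained (proj₁ ∘ proj₁) ∏-base q , ℤ∣.∣-trans (divides (+ (5 ℕ.^ 7)) ≡.refl) 5⁸∣z }
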